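{- Let $T$ be a tree shape on $n$ nodes with a root $u_0$ such that every root-to-leaf path of $T$ contains $O(k)$ turning points. Then, in the connectivity graph model, $T$ can be grown from a single node (placed at $u_0$) in $O(k\log n)$ time steps; specifically, the process "BFS on line segments" does so: in phases $i=1,2,\dots$, for every line segment $s_i$ of $T$ at segment distance $i$ from $u_0$, with endpoints $u_{i-1}$ (closer to $u_0$) and $u_i$, it grows $s_i$ together with $u_i$ starting from $u_{i-1}$ by fast line growth, all these segments in parallel.
   Context: Shapes. Grid points are integer pairs $(x,y)$; two grid points are adjacent if they are at orthogonal (Manhattan) distance $1$. A shape $S=(V,E)$ is a finite connected graph whose nodes occupy distinct grid points and whose edges join only pairs of nodes occupying adjacent points; shapes are considered up to translation, and $n=|V|$. Growth operations. One node, the anchor $u_0$, is stationary; other nodes move relative to it, and a tree is rooted at $u_0$. A growth operation on a node $u$ toward an adjacent grid point $p$ either (i) if $u$ has no edge to $p$, creates a new node $u'$ at $p$ with edge $uu'$; or (ii) if $p$ is occupied by a node $v$ with $uv\in E$, creates a new node $u'$ at $p$, replaces edge $uv$ by edges $uu',u'v$, and translates by one unit, along the axis of $uv$, the part of the tree hanging from whichever of $u,v$ is farther from $u_0$, away from the other endpoint. In one time step a set of operations is applied concurrently, each node receiving at most one operation and all operations having the same cardinal direction; the displacement of each node is the sum of the unit vectors contributed by the operations on its path to $u_0$. The set is collision-free if no two nodes collide during these motions or end at the same point. Growth processes (connectivity graph model). A growth process from an initial shape $S_0$ performs time steps $t=1,2,\dots$, each applying a collision-free set of growth operations to the current shape;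 no edges are deleted and no edges are created other than by the operations. It grows $S$ from $S_0$ in $t_f$ time steps if the shape obtained after step $t_f$ is $S$. Turning points. A node $u$ of a path is a turning point of the path if it is an endpoint or its two path-neighbors $v_1,v_2$ satisfy $v_1u\perp uv_2$. A root-to-leaf path of $T$ is thus an alternating sequence $(u_0,s_1,u_1,\dots,s_j,u_j)$ of turning points and maximal straight line segments; the segment distance of $s_i$ (and of $u_i$) from $u_0$ is $i$. Fast line growth grows a straight segment of length $m$ from a single node in $O(\log m)$ time steps by repeatedly having every node of the segment generate a new node along the segment direction. -}

module Defs where

open import Data.Bool using (if_then_else_)
open import Data.Empty using (⊥)
open import Data.Integer as ℤ using (ℤ; +_; 0ℤ; 1ℤ; -1ℤ)
open import Data.List using (List; []; _∷_; _++_; length)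
open import Data.List.Membership.Propositional using (_∈_; _∉_)
open import Data.List.Relation.Unary.All as All using ()
open import Data.List.Relation.Unary.AllPairs as AllPairs using ()
open import Data.List.Relation.Unary.Any using (here)
open import Data.List.Relation.Unary.Unique.Propositional using (Unique)
open import Data.Nat as ℕ using (ℕ; zero; suc; pred; _≤_)
open import Data.Product using (_×_; _,_; ∃-syntax)
open import Data.Product.Properties using (≡-dec)
open import Data.Sum using (_⊎_)
open import Function.Bundles using (_⇔_)
open import Level using (0ℓ)
open import Relation.Binary.Construct.Closure.ReflexiveTransitive using (Star; ε)
open import Relation.Binary.Construct.Closure.Symmetric using (SymClosure)
open import Relation.Binary.Core using (Rel)
import Relation.Binary.Definitions as Bin
open import Relation.Binary.PropositionalEquality using (_≡_; _≢_; refl)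
open import Relation.Nullary using (¬_; Dec; no; does)
open import Relation.Nullary.Decidable using (_×-dec_; _⊎-dec_)
import Relation.Unary as Un

Point : Set
Point = ℤ × ℤ

origin : Point
origin = 0ℤ , 0ℤ

_≟_ : Bin.DecidableEquality Point
_≟_ = ≡-dec ℤ._≟_ ℤ._≟_

infixl 6 _⊕_ _⊖_
infixl 7 _•_

_⊕_ _⊖_ : Point → Point → Point
(x , y) ⊕ (x′ , y′) = x ℤ.+ x′ , y ℤ.+ y′
(x , y) ⊖ (x′ , y′) = x ℤ.- x′ , y ℤ.- y′

_•_ : ℕ → Point → Point
m • (x , y) = + m ℤ.* x , + m ℤ.* y

dot : Point → Point → ℤ
dot (x , y) (x′ , y′) = x ℤ.* x′ ℤ.+ y ℤ.* y′

manhattan : Point → Point → ℕ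
manhattan (x , y) (x′ , y′) = ℤ.∣ x ℤ.- x′ ∣ ℕ.+ ℤ.∣ y ℤ.- y′ ∣

data Dir : Set where
  north east south west : Dir

vec : Dir → Point
vec north = 0ℤ  , 1ℤ
vec east  = 1ℤ  , 0ℤ
vec south = 0ℤ  , -1ℤ
vec west  = -1ℤ , 0ℤ

-- Since nodes occupy distinct points, a node is identified with the
-- point it currently occupies.
record Shape : Set₁ where
  infix 4 _~_
  field
    nodes      : List Point
    distinct   : Unique nodes
    _~_        : Rel Point 0ℓ
    _~?_       : Bin.Decidable _~_
    ~-sym      : ∀ {p q} → p ~ q → q ~ p
    ~-node     : ∀ {p q} → p ~ q → p ∈ nodes
    ~-adjacent : ∀ {p q} → p ~ q → manhattan p q ≡ 1
    connected  : ∀ {p q} → p ∈ nodes → q ∈ nodes → Star _~_ p q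

  size : ℕ
  size = length nodes

open Shape using (nodes; size)

infix 4 _≋_

-- Equality of placed shapes.  No translation is quotiented out: a growth
-- process has a stationary anchor, which fixes the placement.
_≋_ : Shape → Shape → Set
S ≋ S′ = (∀ p → p ∈ nodes S ⇔ p ∈ nodes S′)
       × (∀ p q → Shape._~_ S p q ⇔ Shape._~_ S′ p q)

singleton : Point → Shape
singleton p = record
  { nodes      = p ∷ []
  ; distinct   = All.[] AllPairs.∷ AllPairs.[]
  ; _~_        = λ _ _ → ⊥
  ; _~?_       = λ _ _ → no (λ ())
  ; ~-sym      = λ ()
  ; ~-node     = λ ()
  ; ~-adjacent = λ ()
  ; connected  = λ { (here refl) (here refl) → ε }
  }

-- Path S a b ps: ps is a simple path from a to b.  The nodes are listed
-- backwards, so b is the head of ps and a is its last element.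
data Path (S : Shape) (a : Point) : Point → List Point → Set where
  start  : Path S a a (a ∷ [])
  extend : ∀ {b c ps} → Path S a b ps → Shape._~_ S b c → c ∉ ps →
           Path S a c (c ∷ ps)

-- Shapes are connected, so a tree shape is an acyclic one.
IsTree : Shape → Set
IsTree S = ∀ {a b ps} → Path S a b ps → 3 ≤ length ps → ¬ Shape._~_ S b a

Perpendicular : Point → Point → Point → Set
Perpendicular v₁ u v₂ = dot (u ⊖ v₁) (v₂ ⊖ u) ≡ 0ℤ

perpendicular? : ∀ v₁ u v₂ → Dec (Perpendicular v₁ u v₂)
perpendicular? v₁ u v₂ = dot (u ⊖ v₁) (v₂ ⊖ u) ℤ.≟ 0ℤ

innerTurns : List Point → ℕ
innerTurns (v₁ ∷ u ∷ v₂ ∷ ps) =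
  (if does (perpendicular? v₁ u v₂) then 1 else 0) ℕ.+ innerTurns (u ∷ v₂ ∷ ps)
innerTurns _ = 0

turningPoints : List Point → ℕ
turningPoints []           = 0
turningPoints (_ ∷ [])     = 1
turningPoints (p ∷ q ∷ ps) = 2 ℕ.+ innerTurns (p ∷ q ∷ ps)

-- A path (u₀, s₁, u₁, …, sⱼ, uⱼ) has j + 1 turning points and j segments.
segments : List Point → ℕ
segments ps = pred (turningPoints ps)

-- A leaf is a node without children; in particular the root of a
-- one-node tree is a leaf, and a root of degree one is not.
RootToLeaf : Shape → Point → Point → List Point → Set
RootToLeaf T u₀ v ps = Path T u₀ v ps × (∀ w → Shape._~_ T v w → w ∈ ps)

-- The points b + m d, …, b + 2 d, b + d.
line : Point → Dir → ℕ → List Point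
line b d zero    = []
line b d (suc m) = (b ⊕ suc m • vec d) ∷ line b d m

-- A maximal straight segment sᵢ of T with uᵢ₋₁ = b and uᵢ = b + m d.
-- When the paths to different leaves leave a straight line at different
-- nodes, their segments are initial parts of the one considered here.
record Segment (T : Shape) (u₀ : Point) (i : ℕ) (b : Point) (d : Dir) (m : ℕ) : Set where
  field
    nonempty     : 1 ≤ m
    before       : List Point
    path-to-base : Path T u₀ b before
    path-to-end  : Path T u₀ (b ⊕ m • vec d) (line b d m ++ before)
    base-dist    : suc (segments before) ≡ i
    end-dist     : segments (line b d m ++ before) ≡ i
    maximal      : ¬ Shape._~_ T (b ⊕ m • vec d) (b ⊕ suc m • vec d)

-- Nodes present after a step: old v is a previous node v, new u is the
-- node generated by u.
data Body : Set where
  old new : Point → Body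

-- The operations of one time step: every node u with Op u grows toward
-- u ⊕ vec dir.
record Operations (S : Shape) : Set₁ where
  field
    dir : Dir
    Op  : Un.Pred Point 0ℓ
    op? : Un.Decidable Op
    op∈ : ∀ {u} → Op u → u ∈ nodes S

  Toward : Rel Point 0ℓ
  Toward u v = Op u × v ≡ u ⊕ vec dir

  -- For an edge uv: it is replaced by two edges.
  Splits : Rel Point 0ℓ
  Splits u v = Toward u v ⊎ Toward v u

  splits? : Bin.Decidable Splits
  splits? u v = (op? u ×-dec (v ≟ (u ⊕ vec dir))) ⊎-dec (op? v ×-dec (u ≟ (v ⊕ vec dir)))

  -- The argument is a path from the anchor, so in c ∷ p ∷ ps the node p
  -- is the parent of c; splitting pc pushes c away from p, whichever of
  -- the two received the operation.
  displacement : List Point → Point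
  displacement (c ∷ p ∷ ps) =
    (if does (splits? p c) then c ⊖ p else origin) ⊕ displacement (p ∷ ps)
  displacement _ = origin

  Present : Un.Pred Body 0ℓ
  Present (old v) = v ∈ nodes S
  Present (new u) = Op u

  data Edge : Rel Body 0ℓ where
    kept    : ∀ {u v} → Shape._~_ S u v → ¬ Splits u v → Edge (old u) (old v)
    grown   : ∀ {u} → Op u → Edge (old u) (new u)
    spliced : ∀ {u v} → Shape._~_ S u v → Toward u v → Edge (new u) (old v)

  -- A generated node emerges from its generator during the step and ends
  -- next to it.
  initial : Body → Point
  initial (old v) = v
  initial (new u) = u

  -- move v is the point to which a previous node v is translated.
  final : (move : Point → Point) → Body → Point
  final move (old v) = move v
  final move (new u) = move u ⊕ vec dir

record Step (u₀ : Point) (S S′ : Shape) : Set₁ where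
  field
    tree   : IsTree S
    anchor : u₀ ∈ nodes S
    ops    : Operations S

  open Operations ops public

  field
    move     : Point → Point
    move-def : ∀ {v ps} → Path S u₀ v ps → move v ≡ v ⊕ displacement ps

    -- All motions are uniform.  At time a / (a + r) of the step a body x is
    -- at the point (r • initial x ⊕ a • final move x) / (a + r).  With a ≥ 1
    -- these are the rational times in (0,1]; trajectories with integral
    -- endpoints that meet at some real time also meet at a rational one.
    collision-free : ∀ {x y} → Present x → Present y → x ≢ y → ∀ a r → 1 ≤ a →
                     r • initial x ⊕ a • final move x ≢ r • initial y ⊕ a • final move y
    nodes′ : ∀ p → p ∈ nodes S′ ⇔ (∃[ x ] Present x × final move x ≡ p)
    edges′ : ∀ p q → Shape._~_ S′ p q ⇔
             (∃[ x ] ∃[ y ] SymClosure Edge x y × final move x ≡ p × final move y ≡ q)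

infixr 5 _∷_

data Growth (u₀ : Point) : Shape → Shape → ℕ → Set₁ where
  done : ∀ {S S′} → S ≋ S′ → Growth u₀ S S′ 0
  _∷_  : ∀ {S S′ S″ t} → Step u₀ S S′ → Growth u₀ S′ S″ t → Growth u₀ S S″ (suc t)

module _ (T : Shape) (u₀ : Point) where

  -- The points of T at segment distance at most i from u₀; a point inside
  -- a segment has the segment distance of that segment.
  Within : ℕ → Point → Set
  Within i p = ∃[ ps ] Path T u₀ p ps × segments ps ≤ i

  -- S is the part of T consisting of the segments at distance at most i.
  GrownUpTo : ℕ → Shape → Set
  GrownUpTo i S =
    (∀ p → p ∈ nodes S ⇔ Within i p) ×
    (∀ p q → Shape._~_ S p q ⇔ (Shape._~_ T p q × Within i p × Within i q))

  -- A step of phase i.  Only operations of a single direction are allowed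
  -- in a step, so it advances in parallel all segments at distance i having
  -- that direction.  Each node of such a segment grown so far, including
  -- the base, generates a node along the segment, unless fewer operations
  -- suffice to complete the segment.
  record FastLineStep (i : ℕ) {S S′ : Shape} (st : Step u₀ S S′) : Set where
    open Step st using (Op; dir)
    field
      only-segments : ∀ {u} → Op u →
        ∃[ b ] ∃[ m ] Segment T u₀ i b dir m × u ∈ (b ∷ line b dir m)
      all-segments : ∀ {b m} → Segment T u₀ i b dir m →
        (∀ {u} → u ∈ nodes S → u ∈ (b ∷ line b dir m) → Op u) ⊎
        (∀ {u} → u ∈ line b dir m → u ∈ nodes S′)

  -- Phase i g: g is the remainder, from some moment of phase i on, of a run
  -- of BFS on line segments.
  data Phase : ℕ → ∀ {S t} → Growth u₀ S T t → Set₁ where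
    finish : ∀ {i S} {e : S ≋ T} → Phase i (done {S = S} {S′ = T} e)
    grow   : ∀ {i S S′ t} {st : Step u₀ S S′} {g : Growth u₀ S′ T t} →
             FastLineStep i st → Phase i g → Phase i (st ∷ g)
    next   : ∀ {i S t} {g : Growth u₀ S T t} →
             GrownUpTo i S → Phase (suc i) g → Phase i g

  BFSOnLineSegments : ∀ {t} → Growth u₀ (singleton u₀) T t → Set₁
  BFSOnLineSegments g = Phase 1 g

{-# OPTIONS --safe #-}
module Submission where

-- Each intermediate shape is the part of T formed by the segments at distance
-- less than i from u₀ and, for those at distance i, by an initial part of length
-- at most cap d in direction d.  A step in direction d turns w = cap d into
-- 2 w + 1: on a segment of length len the node at offset y receives an operation
-- iff y < μ := quota w len, so the old node at offset x moves to
-- stretch μ x = x + min x μ and the node generated at y ends just beyond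
-- stretch μ y.  No two nodes collide: a node that would be overtaken lies ahead
-- on the same segment and is displaced at least as far.
-- The first n rounds over the four directions of a phase raise every cap to
-- 2^n − 1.  Taking 2 ⌊log₂ |T|⌋ rounds suffices, as |T| ≤ 2^(2 ⌊log₂ |T|⌋), and
-- needs no time at all when |T| = 1; hence 8 ⌊log₂ |T|⌋ steps per phase.

open import Defs
open import Data.Bool using (Bool; true; if_then_else_)
open import Data.Empty using (⊥; ⊥-elim)
open import Data.Integer as ℤ using (ℤ; +_; -[1+_]; 0ℤ; 1ℤ)
import Data.Integer.Properties as ℤₚ
open import Data.Integer.Tactic.RingSolver using (solve-∀)
open import Data.List using (List; []; _∷_; _++_; length; filter)
open import Data.List.Membership.DecPropositional _≟_ using (_∈?_)
open import Data.List.Membership.Propositional using (_∈_; _∉_; find; lose)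
open import Data.List.Membership.Propositional.Properties
  using (∈-∃++; ∈-++⁻; ∈-++⁺ˡ; ∈-++⁺ʳ; ∈-filter⁺; ∈-filter⁻)
open import Data.List.Properties using (length-++; ∷-injectiveʳ)
open import Data.List.Relation.Binary.Subset.Propositional using (_⊆_)
open import Data.List.Relation.Unary.All as All using (All; []; _∷_)
open import Data.List.Relation.Unary.All.Properties using (¬Any⇒All¬; All¬⇒¬Any)
open import Data.List.Relation.Unary.AllPairs using ([]; _∷_)
open import Data.List.Relation.Unary.Any using (here; there; any?)
open import Data.List.Relation.Unary.Unique.Propositional using (Unique)
import Data.List.Relation.Unary.Unique.Propositional.Properties as Unique
open import Data.Nat as ℕ
  using (ℕ; zero; suc; _+_; _*_; _^_; _∸_; _⊓_; _≤_; _<_; z≤n; s≤s; NonZero; >-nonZero)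
open import Data.Nat.GeneralisedArithmetic using (iterate)
open import Data.Nat.Logarithm using (⌊log₂_⌋; ⌊log₂⌋-mono-≤; ⌊log₂[2^n]⌋≡n)
open import Data.Nat.Properties hiding (_≟_)
import Data.Nat.Tactic.RingSolver as ℕ-Solver
open import Data.Product as Product using (∃-syntax; _×_; _,_; proj₁; proj₂)
open import Data.Product.Function.NonDependent.Propositional using (_×-⇔_)
open import Data.Sum as Sum using (_⊎_; inj₁; inj₂)
open import Data.Unit using (tt)
open import Function using (_∘_; const; id)
open import Function.Bundles using (_⇔_; mk⇔; Equivalence)
open import Function.Construct.Composition using (_⇔-∘_)
open import Function.Construct.Identity using (⇔-id)
open import Level using (0ℓ)
open import Relation.Binary.Construct.Closure.ReflexiveTransitive as Star using (Star; ε; _◅_; _◅◅_)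
open import Relation.Binary.Construct.Closure.Symmetric using (SymClosure; fwd; bwd; symmetric)
open import Relation.Binary.Core using (Rel)
open import Relation.Binary.Definitions using (DecidableEquality; Symmetric; tri<; tri≈; tri>)
open import Relation.Binary.PropositionalEquality
open import Relation.Nullary using (¬_; Dec; yes; no; does; contradiction)
open import Relation.Nullary.Decidable
  using (dec-true; dec-false; _×-dec_; ¬?; map′; decidable-stable)
open import Relation.Unary using (Pred; Decidable)
open import Algebra.Definitions {A = Point} _≡_
  using (Associative; LeftIdentity; RightIdentity; LeftCancellative; RightCancellative)
open Equivalence using (to; from)

-- Vectors and directions

⊕-assoc : Associative _⊕_
⊕-assoc (x , y) (x′ , y′) (x″ , y″) = cong₂ _,_ (ℤₚ.+-assoc x x′ x″) (ℤₚ.+-assoc y y′ y″)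

⊕-identityˡ : LeftIdentity origin _⊕_
⊕-identityˡ (x , y) = cong₂ _,_ (ℤₚ.+-identityˡ x) (ℤₚ.+-identityˡ y)

⊕-identityʳ : RightIdentity origin _⊕_
⊕-identityʳ (x , y) = cong₂ _,_ (ℤₚ.+-identityʳ x) (ℤₚ.+-identityʳ y)

[p⊕v]⊖p≡v : ∀ p v → (p ⊕ v) ⊖ p ≡ v
[p⊕v]⊖p≡v (x , y) (v , w) = cong₂ _,_ (i+j-i≡j x v) (i+j-i≡j y w)
  where
  i+j-i≡j : ∀ i j → i ℤ.+ j ℤ.- i ≡ j
  i+j-i≡j = solve-∀

[p⊕v]⊖v≡p : ∀ p v → (p ⊕ v) ⊖ v ≡ p
[p⊕v]⊖v≡p (x , y) (v , w) = cong₂ _,_ (i+j-j≡i x v) (i+j-j≡i y w)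
  where
  i+j-j≡i : ∀ i j → i ℤ.+ j ℤ.- j ≡ i
  i+j-j≡i = solve-∀

p⊕[q⊖p]≡q : ∀ p q → p ⊕ (q ⊖ p) ≡ q
p⊕[q⊖p]≡q (x , y) (x′ , y′) = cong₂ _,_ (i+[j-i]≡j x x′) (i+[j-i]≡j y y′)
  where
  i+[j-i]≡j : ∀ i j → i ℤ.+ (j ℤ.- i) ≡ j
  i+[j-i]≡j = solve-∀

⊕-cancelˡ : LeftCancellative _⊕_
⊕-cancelˡ p v w eq = trans (sym ([p⊕v]⊖p≡v p v)) (trans (cong (_⊖ p) eq) ([p⊕v]⊖p≡v p w))

⊕-cancelʳ : RightCancellative _⊕_
⊕-cancelʳ v p q eq = trans (sym ([p⊕v]⊖v≡p p v)) (trans (cong (_⊖ v) eq) ([p⊕v]⊖v≡p q v))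

•-identityˡ : ∀ v → 1 • v ≡ v
•-identityˡ (x , y) = cong₂ _,_ (ℤₚ.*-identityˡ x) (ℤₚ.*-identityˡ y)

•-distribʳ-+ : ∀ v m n → (m + n) • v ≡ m • v ⊕ n • v
•-distribʳ-+ (x , y) m n = cong₂ _,_ (ℤₚ.*-distribʳ-+ x (+ m) (+ n)) (ℤₚ.*-distribʳ-+ y (+ m) (+ n))

suc-• : ∀ n v → suc n • v ≡ v ⊕ n • v
suc-• n v = trans (•-distribʳ-+ v 1 n) (cong (_⊕ n • v) (•-identityˡ v))

infixl 7 _⊛_

_⊛_ : ℤ → Point → Point
c ⊛ (x , y) = c ℤ.* x , c ℤ.* y

⊛-assoc : ∀ b c v → (b ℤ.* c) ⊛ v ≡ b ⊛ (c ⊛ v)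
⊛-assoc b c (x , y) = cong₂ _,_ (ℤₚ.*-assoc b c x) (ℤₚ.*-assoc b c y)

⊛-cancelˡ : ∀ c .{{_ : ℤ.NonZero c}} v w → c ⊛ v ≡ c ⊛ w → v ≡ w
⊛-cancelˡ c (x , y) (x′ , y′) eq =
  cong₂ _,_ (ℤₚ.*-cancelˡ-≡ c x x′ (cong proj₁ eq)) (ℤₚ.*-cancelˡ-≡ c y y′ (cong proj₂ eq))

⊕-⊛-reverse : ∀ c u v w → v ≡ u ⊕ c ⊛ w → u ≡ v ⊕ (ℤ.- c) ⊛ w
⊕-⊛-reverse c (x , y) _ (e , f) refl = cong₂ _,_ (cancel c x e) (cancel c y f)
  where
  cancel : ∀ c x e → x ≡ x ℤ.+ c ℤ.* e ℤ.+ (ℤ.- c) ℤ.* e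
  cancel = solve-∀

dot-⊛ : ∀ c v w → dot (c ⊛ v) w ≡ c ℤ.* dot v w
dot-⊛ c (v₁ , v₂) (w₁ , w₂) = factor c v₁ v₂ w₁ w₂
  where
  factor : ∀ c v₁ v₂ w₁ w₂ → c ℤ.* v₁ ℤ.* w₁ ℤ.+ c ℤ.* v₂ ℤ.* w₂ ≡ c ℤ.* (v₁ ℤ.* w₁ ℤ.+ v₂ ℤ.* w₂)
  factor = solve-∀

dot-corner : ∀ {c p} q v w → c ≡ p ⊕ v → p ≡ q ⊕ w → dot (p ⊖ c) (q ⊖ p) ≡ dot v w
dot-corner (x , y) (v₁ , v₂) (w₁ , w₂) refl refl = expand x y v₁ v₂ w₁ w₂
  where
  expand : ∀ x y v₁ v₂ w₁ w₂ →
    (x ℤ.+ w₁ ℤ.- (x ℤ.+ w₁ ℤ.+ v₁)) ℤ.* (x ℤ.- (x ℤ.+ w₁)) ℤ.+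
    (y ℤ.+ w₂ ℤ.- (y ℤ.+ w₂ ℤ.+ v₂)) ℤ.* (y ℤ.- (y ℤ.+ w₂)) ≡ v₁ ℤ.* w₁ ℤ.+ v₂ ℤ.* w₂
  expand = solve-∀

manhattan-refl : ∀ p → manhattan p p ≡ 0
manhattan-refl (x , y) = cong₂ (λ a b → ℤ.∣ a ∣ + ℤ.∣ b ∣) (ℤₚ.+-inverseʳ x) (ℤₚ.+-inverseʳ y)

toDir : Point → Dir
toDir (+ suc _  , _)        = east
toDir (-[1+ _ ] , _)        = west
toDir (+ 0      , -[1+ _ ]) = south
toDir (+ 0      , + _)      = north

toDir-vec : ∀ d → toDir (vec d) ≡ d
toDir-vec north = refl
toDir-vec east  = refl
toDir-vec south = refl
toDir-vec west  = refl

vec-injective : ∀ {d e} → vec d ≡ vec e → d ≡ e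
vec-injective {d} {e} eq = trans (sym (toDir-vec d)) (trans (cong toDir eq) (toDir-vec e))

_≟ᵈ_ : DecidableEquality Dir
d ≟ᵈ e = map′ vec-injective (cong vec) (vec d ≟ vec e)

dot-vec : ∀ d → dot (vec d) (vec d) ≡ 1ℤ
dot-vec north = refl
dot-vec east  = refl
dot-vec south = refl
dot-vec west  = refl

dot-⊛-vec : ∀ c d → dot (c ⊛ vec d) (vec d) ≡ c
dot-⊛-vec c d = begin
  dot (c ⊛ vec d) (vec d)      ≡⟨ dot-⊛ c (vec d) (vec d) ⟩
  c ℤ.* dot (vec d) (vec d)    ≡⟨ cong (c ℤ.*_) (dot-vec d) ⟩
  c ℤ.* 1ℤ                     ≡⟨ ℤₚ.*-identityʳ c ⟩
  c                            ∎
  where open ≡-Reasoning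

data Angle (d e : Dir) : Set where
  same          : d ≡ e → Angle d e
  opposite      : vec e ⊕ vec d ≡ origin → Angle d e
  perpendicular : dot (vec d) (vec e) ≡ 0ℤ → Angle d e

angle : ∀ d e → Angle d e
angle north north = same refl
angle north east  = perpendicular refl
angle north south = opposite refl
angle north west  = perpendicular refl
angle east  north = perpendicular refl
angle east  east  = same refl
angle east  south = perpendicular refl
angle east  west  = opposite refl
angle south north = opposite refl
angle south east  = perpendicular refl
angle south south = same refl
angle south west  = perpendicular refl
angle west  north = perpendicular refl
angle west  east  = opposite refl
angle west  south = perpendicular refl
angle west  west  = same refl

at : Point → Dir → ℕ → Point
at b d x = b ⊕ x • vec d

at-zero : ∀ b d → at b d 0 ≡ b
at-zero b _ = ⊕-identityʳ b

at-+ : ∀ b d x y → at (at b d x) d y ≡ at b d (x + y)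
at-+ b d x y = trans (⊕-assoc b _ _) (cong (b ⊕_) (sym (•-distribʳ-+ (vec d) x y)))

at-beyond : ∀ {p} b d x y → p ≡ at b d x → at p d y ≡ at b d (x + y)
at-beyond b d x y refl = at-+ b d x y

at-one : ∀ b d → at b d 1 ≡ b ⊕ vec d
at-one b d = cong (b ⊕_) (•-identityˡ (vec d))

at-suc-at : ∀ b d x → at b d (suc x) ≡ at (at b d x) d 1
at-suc-at b d x = trans (cong (at b d) (+-comm 1 x)) (sym (at-+ b d x 1))

at-suc : ∀ b d x → at b d (suc x) ≡ at b d x ⊕ vec d
at-suc b d x = trans (at-suc-at b d x) (at-one (at b d x) d)

at-injective : ∀ b d x y → at b d x ≡ at b d y → x ≡ y
at-injective b d x y eq = ℤₚ.+-injective (begin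
  + x                          ≡⟨ dot-⊛-vec (+ x) d ⟨
  dot (x • vec d) (vec d)      ≡⟨ cong (λ v → dot v (vec d)) (⊕-cancelˡ b (x • vec d) (y • vec d) eq) ⟩
  dot (y • vec d) (vec d)      ≡⟨ dot-⊛-vec (+ y) d ⟩
  + y                          ∎)
  where open ≡-Reasoning

adjacent⇒at : ∀ p q → manhattan p q ≡ 1 → ∃[ d ] q ≡ at p d 1
adjacent⇒at (x , y) (x′ , y′) adj = neighbour (x ℤ.- x′) (y ℤ.- y′) refl refl adj
  where
  i′≡i-[i-i′] : ∀ i i′ → i′ ≡ i ℤ.- (i ℤ.- i′)
  i′≡i-[i-i′] = solve-∀
  shifted : ∀ i i′ {s} → i ℤ.- i′ ≡ s → i′ ≡ i ℤ.- s
  shifted i i′ refl = i′≡i-[i-i′] i i′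
  neighbour : ∀ s t → x ℤ.- x′ ≡ s → y ℤ.- y′ ≡ t → ℤ.∣ s ∣ + ℤ.∣ t ∣ ≡ 1 →
              ∃[ d ] (x′ , y′) ≡ at (x , y) d 1
  neighbour (+ 0)      (+ 1)      p q _ = south , cong₂ _,_ (shifted x x′ p) (shifted y y′ q)
  neighbour (+ 0)      (-[1+ 0 ]) p q _ = north , cong₂ _,_ (shifted x x′ p) (shifted y y′ q)
  neighbour (+ 1)      (+ 0)      p q _ = west  , cong₂ _,_ (shifted x x′ p) (shifted y y′ q)
  neighbour (-[1+ 0 ]) (+ 0)      p q _ = east  , cong₂ _,_ (shifted x x′ p) (shifted y y′ q)

-- Uniform motion in a common direction

scaled-collinear : ∀ q .{{_ : ℤ.NonZero q}} n v d → q ⊛ v ≡ n ⊛ vec d →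
                   ∃[ c ] v ≡ c ⊛ vec d × q ℤ.* c ≡ n
scaled-collinear q n v d eq = c , ⊛-cancelˡ q v (c ⊛ vec d) q⊛v≡q⊛[c⊛vec] , q*c≡n
  where
  open ≡-Reasoning
  c : ℤ
  c = dot v (vec d)
  q*c≡n : q ℤ.* c ≡ n
  q*c≡n = begin
    q ℤ.* c                    ≡⟨ dot-⊛ q v (vec d) ⟨
    dot (q ⊛ v) (vec d)        ≡⟨ cong (λ p → dot p (vec d)) eq ⟩
    dot (n ⊛ vec d) (vec d)    ≡⟨ dot-⊛-vec n d ⟩
    n                          ∎
  q⊛v≡q⊛[c⊛vec] : q ⊛ v ≡ q ⊛ (c ⊛ vec d)
  q⊛v≡q⊛[c⊛vec] = begin
    q ⊛ v                      ≡⟨ eq ⟩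
    n ⊛ vec d                  ≡⟨ cong (_⊛ vec d) q*c≡n ⟨
    (q ℤ.* c) ⊛ vec d          ≡⟨ ⊛-assoc q c (vec d) ⟩
    q ⊛ (c ⊛ vec d)            ∎

Overtakes : Dir → (u : Point) (k : ℕ) (v : Point) (l : ℕ) → Set
Overtakes d u k v l = ∃[ t ] v ≡ at u d (suc t) × suc t + l ≤ k

-- At time a / (a + r), a body moving uniformly from u to at u d k is at
-- (r • u ⊕ a • at u d k) / (a + r).
module _ (d : Dir) (a r : ℕ) (1≤a : 1 ≤ a) where

  private
    instance
      a≢0 : NonZero a
      a≢0 = >-nonZero 1≤a
      r+a≢0 : NonZero (r + a)
      r+a≢0 = >-nonZero (≤-trans 1≤a (m≤n+m a r))

  meet⇒scaled-difference : ∀ u v k l → r • u ⊕ a • at u d k ≡ r • v ⊕ a • at v d l →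
    + (r + a) ⊛ (v ⊖ u) ≡ (+ a ℤ.* (+ k ℤ.- + l)) ⊛ vec d
  meet⇒scaled-difference (x , y) (x′ , y′) k l eq = cong₂ _,_
    (coordinate (+ r) (+ a) x x′ (+ k) (+ l) _ (cong proj₁ eq))
    (coordinate (+ r) (+ a) y y′ (+ k) (+ l) _ (cong proj₂ eq))
    where
    open ≡-Reasoning
    position : ℤ → ℤ → ℤ → ℤ → ℤ → ℤ
    position r a x k e = r ℤ.* x ℤ.+ a ℤ.* (x ℤ.+ k ℤ.* e)
    difference : ∀ r a x x′ k l e → (r ℤ.+ a) ℤ.* (x′ ℤ.- x) ≡
      (r ℤ.* x′ ℤ.+ a ℤ.* (x′ ℤ.+ l ℤ.* e)) ℤ.- (r ℤ.* x ℤ.+ a ℤ.* (x ℤ.+ k ℤ.* e)) ℤ.+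
      a ℤ.* (k ℤ.- l) ℤ.* e
    difference = solve-∀
    coordinate : ∀ r a x x′ k l e → position r a x k e ≡ position r a x′ l e →
                 (r ℤ.+ a) ℤ.* (x′ ℤ.- x) ≡ a ℤ.* (k ℤ.- l) ℤ.* e
    coordinate r a x x′ k l e eq = begin
      (r ℤ.+ a) ℤ.* (x′ ℤ.- x)
        ≡⟨ difference r a x x′ k l e ⟩
      position r a x′ l e ℤ.- position r a x k e ℤ.+ a ℤ.* (k ℤ.- l) ℤ.* e
        ≡⟨ cong (ℤ._+ a ℤ.* (k ℤ.- l) ℤ.* e) (ℤₚ.i≡j⇒i-j≡0 (sym eq)) ⟩
      0ℤ ℤ.+ a ℤ.* (k ℤ.- l) ℤ.* e
        ≡⟨ ℤₚ.+-identityˡ _ ⟩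
      a ℤ.* (k ℤ.- l) ℤ.* e
        ∎

  lead-bound : ∀ t k l → + (r + a) ℤ.* + t ≡ + a ℤ.* (+ k ℤ.- + l) → t + l ≤ k
  lead-bound t k l eq = *-cancelˡ-≤ a (≤-trans (m≤n+m _ (r * t)) (≤-reflexive (ℤₚ.+-injective scaled)))
    where
    open ≡-Reasoning
    regroup : ∀ r a t l → r ℤ.* t ℤ.+ a ℤ.* (t ℤ.+ l) ≡ (r ℤ.+ a) ℤ.* t ℤ.+ a ℤ.* l
    regroup = solve-∀
    recombine : ∀ a k l → a ℤ.* (k ℤ.- l) ℤ.+ a ℤ.* l ≡ a ℤ.* k
    recombine = solve-∀
    scaled : + (r * t + a * (t + l)) ≡ + (a * k)
    scaled = begin
      + (r * t + a * (t + l))                  ≡⟨ cong₂ ℤ._+_ (ℤₚ.pos-* r t) (ℤₚ.pos-* a (t + l)) ⟩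
      + r ℤ.* + t ℤ.+ + a ℤ.* (+ t ℤ.+ + l)    ≡⟨ regroup (+ r) (+ a) (+ t) (+ l) ⟩
      + (r + a) ℤ.* + t ℤ.+ + a ℤ.* + l        ≡⟨ cong (ℤ._+ + a ℤ.* + l) eq ⟩
      + a ℤ.* (+ k ℤ.- + l) ℤ.+ + a ℤ.* + l    ≡⟨ recombine (+ a) (+ k) (+ l) ⟩
      + a ℤ.* + k                              ≡⟨ ℤₚ.pos-* a k ⟨
      + (a * k)                                ∎

  swap-roles : ∀ c k l → + (r + a) ℤ.* c ≡ + a ℤ.* (+ k ℤ.- + l) →
               + (r + a) ℤ.* (ℤ.- c) ≡ + a ℤ.* (+ l ℤ.- + k)
  swap-roles c k l eq = begin
    + (r + a) ℤ.* (ℤ.- c)          ≡⟨ ℤₚ.neg-distribʳ-* (+ (r + a)) c ⟨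
    ℤ.- (+ (r + a) ℤ.* c)          ≡⟨ cong ℤ.-_ eq ⟩
    ℤ.- (+ a ℤ.* (+ k ℤ.- + l))    ≡⟨ negate (+ a) (+ k) (+ l) ⟩
    + a ℤ.* (+ l ℤ.- + k)          ∎
    where
    open ≡-Reasoning
    negate : ∀ a k l → ℤ.- (a ℤ.* (k ℤ.- l)) ≡ a ℤ.* (l ℤ.- k)
    negate = solve-∀

  meet⇒overtake : ∀ u v k l → r • u ⊕ a • at u d k ≡ r • v ⊕ a • at v d l →
                  (u ≡ v × k ≡ l) ⊎ Overtakes d u k v l ⊎ Overtakes d v l u k
  meet⇒overtake u v k l eq = compare
    (scaled-collinear (+ (r + a)) (+ a ℤ.* (+ k ℤ.- + l)) (v ⊖ u) d
      (meet⇒scaled-difference u v k l eq))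
    where
    v≡u⊕ : ∀ {w} → v ⊖ u ≡ w → v ≡ u ⊕ w
    v≡u⊕ eq = trans (sym (p⊕[q⊖p]≡q u v)) (cong (u ⊕_) eq)
    compare : ∃[ c ] v ⊖ u ≡ c ⊛ vec d × + (r + a) ℤ.* c ≡ + a ℤ.* (+ k ℤ.- + l) →
              (u ≡ v × k ≡ l) ⊎ Overtakes d u k v l ⊎ Overtakes d v l u k
    compare (+ 0 , v⊖u≡ , scaled) = inj₁ (sym (trans (v≡u⊕ v⊖u≡) (at-zero u d)) ,
      ≤-antisym (lead-bound 0 l k (swap-roles 0ℤ k l scaled)) (lead-bound 0 k l scaled))
    compare (+ suc t , v⊖u≡ , scaled) =
      inj₂ (inj₁ (t , v≡u⊕ v⊖u≡ , lead-bound (suc t) k l scaled))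
    compare (c@(-[1+ t ]) , v⊖u≡ , scaled) = inj₂ (inj₂
      (t , ⊕-⊛-reverse c u v (vec d) (v≡u⊕ v⊖u≡) , lead-bound (suc t) l k (swap-roles c k l scaled)))

-- One step on one segment

quota : ℕ → ℕ → ℕ
quota w len = (len ∸ w) ⊓ suc w

<quota⇒≤ : ∀ {y} w len → y < quota w len → y ≤ w
<quota⇒≤ w len y<μ = m<1+n⇒m≤n (<-≤-trans y<μ (m⊓n≤n (len ∸ w) (suc w)))

<quota⇒<len : ∀ {y} w len → y < quota w len → y < len
<quota⇒<len w len y<μ = <-≤-trans y<μ (≤-trans (m⊓n≤m (len ∸ w) (suc w)) (m∸n≤m len w))

<quota⇒≤len : ∀ {y} w len → y < quota w len → y ≤ len
<quota⇒≤len w len = <⇒≤ ∘ <quota⇒<len w len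

≤quota⇒+≤len : ∀ {x k} w len → x ≤ w → x ≤ len → k ≤ quota w len → x + k ≤ len
≤quota⇒+≤len {x} {k} w len x≤w x≤len k≤μ with ≤-total w len
... | inj₁ w≤len = begin
  x + k           ≤⟨ +-mono-≤ x≤w (m≤n⊓o⇒m≤n (len ∸ w) (suc w) k≤μ) ⟩
  w + (len ∸ w)   ≡⟨ m+[n∸m]≡n w≤len ⟩
  len             ∎
  where open ≤-Reasoning
... | inj₂ len≤w = begin
  x + k           ≤⟨ +-mono-≤ x≤len (m≤n⊓o⇒m≤n (len ∸ w) (suc w) k≤μ) ⟩
  len + (len ∸ w) ≡⟨ cong (_+_ len) (m≤n⇒m∸n≡0 len≤w) ⟩
  len + 0         ≡⟨ +-identityʳ len ⟩
  len             ∎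
  where open ≤-Reasoning

≤quota⇒+≤double : ∀ {x k} w len → x ≤ w → k ≤ quota w len → x + k ≤ suc (w + w)
≤quota⇒+≤double {x} {k} w len x≤w k≤μ = begin
  x + k           ≤⟨ +-mono-≤ x≤w (m≤n⊓o⇒m≤o (len ∸ w) (suc w) k≤μ) ⟩
  w + suc w       ≡⟨ +-suc w w ⟩
  suc (w + w)     ∎
  where open ≤-Reasoning

<double⇒<w+quota : ∀ {z} w len → z < len → z < suc (w + w) → z < w + quota w len
<double⇒<w+quota {z} w len z<len z<double = ≤-trans (⊓-glb
  (≤-trans z<len (m≤n+m∸n len w)) (≤-trans z<double (≤-reflexive (sym (+-suc w w)))))
  (≤-reflexive (sym (+-distribˡ-⊓ w (len ∸ w) (suc w))))

quota-full : ∀ {x} w len → suc (w + w) ≤ len → x ≤ w → x < quota w len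
quota-full w len double≤len x≤w =
  ⊓-glb (≤-trans (s≤s x≤w) (m+n≤o⇒m≤o∸n (suc w) double≤len)) (s≤s x≤w)

stretch : ℕ → ℕ → ℕ
stretch μ x = x + x ⊓ μ

suc-⊓-< : ∀ {x μ} → x < μ → suc x ⊓ μ ≡ suc (x ⊓ μ)
suc-⊓-< x<μ = trans (m≤n⇒m⊓n≡m x<μ) (cong suc (sym (m≤n⇒m⊓n≡m (<⇒≤ x<μ))))

suc-⊓-≮ : ∀ {x μ} → ¬ x < μ → suc x ⊓ μ ≡ x ⊓ μ
suc-⊓-≮ x≮μ = trans (m≥n⇒m⊓n≡n (m≤n⇒m≤1+n (≮⇒≥ x≮μ))) (sym (m≥n⇒m⊓n≡n (≮⇒≥ x≮μ)))

stretch-suc-< : ∀ {x μ} → x < μ → stretch μ (suc x) ≡ 2 + stretch μ x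
stretch-suc-< {x} {μ} x<μ = trans (cong (_+_ (suc x)) (suc-⊓-< x<μ)) (cong suc (+-suc x (x ⊓ μ)))

stretch-suc-≮ : ∀ {x μ} → ¬ x < μ → stretch μ (suc x) ≡ suc (stretch μ x)
stretch-suc-≮ {x} x≮μ = cong (_+_ (suc x)) (suc-⊓-≮ x≮μ)

stretch-≤len : ∀ {x} w len → x ≤ w → x ≤ len → stretch (quota w len) x ≤ len
stretch-≤len {x} w len x≤w x≤len = ≤quota⇒+≤len w len x≤w x≤len (m⊓n≤n x (quota w len))

stretch-<len : ∀ {y} w len → y < quota w len → stretch (quota w len) y < len
stretch-<len {y} w len y<μ = subst (_≤ len) (+-suc y (y ⊓ quota w len))
  (≤quota⇒+≤len w len (<quota⇒≤ w len y<μ) (<quota⇒≤len w len y<μ)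
    (≤-trans (s≤s (m⊓n≤m y (quota w len))) y<μ))

-- How the edge from offset z to suc z arises in a step; x and y are offsets
-- before the step.
data EdgeOrigin (w μ z : ℕ) : Set where
  kept    : ∀ x → ¬ x < μ → x < w → z ≡ stretch μ x → EdgeOrigin w μ z
  grown   : ∀ y → y < μ → z ≡ stretch μ y → EdgeOrigin w μ z
  spliced : ∀ y → y < μ → y < w → z ≡ suc (stretch μ y) → EdgeOrigin w μ z

edgeOrigin-stretch : ∀ {w μ z} x → x ≤ w → z < stretch μ x → EdgeOrigin w μ z
edgeOrigin-stretch {μ = μ} {z} (suc x) x<w z<suc with z <? stretch μ x
... | yes z<x = edgeOrigin-stretch x (<⇒≤ x<w) z<x
... | no  z≮x with m≤n⇒m<n∨m≡n (≮⇒≥ z≮x) | x <? μ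
...   | inj₂ refl | yes x<μ = grown x x<μ refl
...   | inj₂ refl | no  x≮μ = kept x x≮μ x<w refl
...   | inj₁ x<z  | yes x<μ = spliced x x<μ x<w
  (≤-antisym (m<1+n⇒m≤n (subst (z <_) (stretch-suc-< x<μ) z<suc)) x<z)
...   | inj₁ x<z  | no  x≮μ =
  contradiction (m<1+n⇒m≤n (subst (z <_) (stretch-suc-≮ x≮μ) z<suc)) (<⇒≱ x<z)

edgeOrigin : ∀ {z} w len → z < len → z < suc (w + w) → EdgeOrigin w (quota w len) z
edgeOrigin {z} w len z<len z<double with z <? stretch (quota w len) w
... | yes z< = edgeOrigin-stretch w ≤-refl z<
... | no  z≮ = grown w w<μ (≤-antisym z≤ (≮⇒≥ z≮))
  where
  μ : ℕ
  μ = quota w len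
  w<μ : w < μ
  w<μ = ≰⇒> λ μ≤w →
    z≮ (subst (λ k → z < w + k) (sym (m≥n⇒m⊓n≡n μ≤w)) (<double⇒<w+quota w len z<len z<double))
  z≤ : z ≤ stretch μ w
  z≤ = subst (λ k → z ≤ w + k) (sym (m≤n⇒m⊓n≡m (<⇒≤ w<μ))) (m<1+n⇒m≤n z<double)

-- Doubling the caps

double : Dir → (Dir → ℕ) → Dir → ℕ
double d cap e = if does (e ≟ᵈ d) then suc (cap d + cap d) else cap e

double-same : ∀ d cap → double d cap d ≡ suc (cap d + cap d)
double-same d cap = cong (if_then suc (cap d + cap d) else cap d) (dec-true (d ≟ᵈ d) refl)

double-other : ∀ d cap {e} → e ≢ d → double d cap e ≡ cap e
double-other d cap {e} e≢d = cong (if_then suc (cap d + cap d) else cap e) (dec-false (e ≟ᵈ d) e≢d)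

doubleAll : (Dir → ℕ) → Dir → ℕ
doubleAll cap = double west (double south (double east (double north cap)))

doubleAll-double : ∀ cap d → doubleAll cap d ≡ suc (cap d + cap d)
doubleAll-double cap north = refl
doubleAll-double cap east  = refl
doubleAll-double cap south = refl
doubleAll-double cap west  = refl

suc-iterate-doubleAll : ∀ n cap d → suc (iterate doubleAll cap n d) ≡ 2 ^ n * suc (cap d)
suc-iterate-doubleAll zero    cap d = sym (+-identityʳ _)
suc-iterate-doubleAll (suc n) cap d = begin
  suc (iterate doubleAll (doubleAll cap) n d)   ≡⟨ suc-iterate-doubleAll n (doubleAll cap) d ⟩
  2 ^ n * suc (doubleAll cap d)                 ≡⟨ cong (λ c → 2 ^ n * suc c) (doubleAll-double cap d) ⟩
  2 ^ n * suc (suc (cap d + cap d))             ≡⟨ regroup (2 ^ n) (cap d) ⟩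
  2 ^ suc n * suc (cap d)                       ∎
  where
  open ≡-Reasoning
  regroup : ∀ p c → p * suc (suc (c + c)) ≡ 2 * p * suc c
  regroup = ℕ-Solver.solve-∀

n<2^[1+⌊log₂n⌋] : ∀ n → n < 2 ^ suc ⌊log₂ n ⌋
n<2^[1+⌊log₂n⌋] n = ≰⇒> λ 2^≤n → 1+n≰n (begin
  suc ⌊log₂ n ⌋               ≡⟨ ⌊log₂[2^n]⌋≡n (suc ⌊log₂ n ⌋) ⟨
  ⌊log₂ 2 ^ suc ⌊log₂ n ⌋ ⌋   ≤⟨ ⌊log₂⌋-mono-≤ 2^≤n ⟩
  ⌊log₂ n ⌋                   ∎)
  where open ≤-Reasoning

n≤2^[2*⌊log₂n⌋] : ∀ n → n ≤ 2 ^ (2 * ⌊log₂ n ⌋)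
n≤2^[2*⌊log₂n⌋] n with ⌊log₂ n ⌋ | n<2^[1+⌊log₂n⌋] n
... | zero  | n<2  = m<1+n⇒m≤n n<2
... | suc l | n<2^ = ≤-trans (<⇒≤ n<2^) (^-monoʳ-≤ 2 (+-mono-≤ (s≤s (z≤n {l})) (m≤m+n (suc l) 0)))

-- Paths

Unique-⊆⇒length-≤ : {A : Set} {xs ys : List A} → Unique xs → xs ⊆ ys → length xs ≤ length ys
Unique-⊆⇒length-≤ {xs = []} _ _ = z≤n
Unique-⊆⇒length-≤ {xs = x ∷ xs} (x∉xs ∷ unique) x∷xs⊆ys with ∈-∃++ (x∷xs⊆ys (here refl))
... | ys , zs , refl = begin
  suc (length xs)              ≤⟨ s≤s (Unique-⊆⇒length-≤ unique xs⊆ys++zs) ⟩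
  suc (length (ys ++ zs))      ≡⟨ cong suc (length-++ ys) ⟩
  suc (length ys + length zs)  ≡⟨ +-suc (length ys) (length zs) ⟨
  length ys + suc (length zs)  ≡⟨ length-++ ys ⟨
  length (ys ++ x ∷ zs)        ∎
  where
  open ≤-Reasoning
  xs⊆ys++zs : xs ⊆ ys ++ zs
  xs⊆ys++zs z∈xs with ∈-++⁻ ys (x∷xs⊆ys (there z∈xs))
  ... | inj₁ z∈ys         = ∈-++⁺ˡ z∈ys
  ... | inj₂ (here refl)  = contradiction refl (All.lookup x∉xs z∈xs)
  ... | inj₂ (there z∈zs) = ∈-++⁺ʳ ys z∈zs

segments-mono : ∀ c p ps → segments (p ∷ ps) ≤ segments (c ∷ p ∷ ps)
segments-mono c p []       = z≤n
segments-mono c p (q ∷ ps) = s≤s (m≤n+m _ _)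

segments-straight : ∀ {c p q} ps → ¬ Perpendicular c p q →
                    segments (c ∷ p ∷ q ∷ ps) ≡ segments (p ∷ q ∷ ps)
segments-straight {c} {p} {q} ps ¬perp =
  cong (λ b → suc ((if b then 1 else 0) + innerTurns (p ∷ q ∷ ps)))
    (dec-false (perpendicular? c p q) ¬perp)

segments-turn : ∀ {c p q} ps → Perpendicular c p q →
                segments (c ∷ p ∷ q ∷ ps) ≡ suc (segments (p ∷ q ∷ ps))
segments-turn {c} {p} {q} ps perp =
  cong (λ b → suc ((if b then 1 else 0) + innerTurns (p ∷ q ∷ ps)))
    (dec-true (perpendicular? c p q) perp)

length-line : ∀ b d x → length (line b d x) ≡ x
length-line b d zero    = refl
length-line b d (suc x) = cong suc (length-line b d x)

∈-line⁻ : ∀ {u} b d m → u ∈ b ∷ line b d m → ∃[ x ] x ≤ m × u ≡ at b d x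
∈-line⁻ b d m       (here refl)         = 0 , z≤n , sym (at-zero b d)
∈-line⁻ b d (suc m) (there (here refl)) = suc m , ≤-refl , refl
∈-line⁻ b d (suc m) (there (there u∈))  =
  Product.map₂ (Product.map₁ m≤n⇒m≤1+n) (∈-line⁻ b d m (there u∈))

∈-line⁺ : ∀ b d m {x} → x ≤ m → at b d x ∈ b ∷ line b d m
∈-line⁺ b d m       {zero}  _         = here (at-zero b d)
∈-line⁺ b d (suc m) {suc x} (s≤s x≤m) with m≤n⇒m<n∨m≡n x≤m
... | inj₂ refl = there (here refl)
... | inj₁ x<m with ∈-line⁺ b d m x<m
...   | here eq   = here eq
...   | there at∈ = there (there at∈)

StartsSegment : Point → Dir → List Point → Set
StartsSegment b d before = segments (line b d 1 ++ before) ≡ suc (segments before)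

Inside : Shape → Pred Point 0ℓ → Rel Point 0ℓ
Inside S P p q = Shape._~_ S p q × P p × P q

Inside-sym : ∀ S P → Symmetric (Inside S P)
Inside-sym S P (e , Pp , Pq) = Shape.~-sym S e , Pq , Pp

~-irrefl : ∀ S {p} → ¬ Shape._~_ S p p
~-irrefl S {p} p~p with () ← trans (sym (Shape.~-adjacent S p~p)) (manhattan-refl p)

module _ {S : Shape} where

  open Shape S using (_~_; _~?_; ~-sym; ~-node; ~-adjacent)

  path-head : ∀ {a b ps} → Path S a b ps → ∃[ qs ] ps ≡ b ∷ qs
  path-head start          = [] , refl
  path-head (extend _ _ _) = _ , refl

  path-head-≡ : ∀ {a b c ps} → Path S a b (c ∷ ps) → b ≡ c
  path-head-≡ start          = refl
  path-head-≡ (extend _ _ _) = refl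

  path-end-unique : ∀ {a b c ps} → Path S a b ps → Path S a c ps → b ≡ c
  path-end-unique p q with _ , refl ← path-head q = path-head-≡ p

  path-end∈ : ∀ {a b ps} → Path S a b ps → b ∈ ps
  path-end∈ p with _ , refl ← path-head p = here refl

  path-start∈ : ∀ {a b ps} → Path S a b ps → a ∈ ps
  path-start∈ start          = here refl
  path-start∈ (extend p _ _) = there (path-start∈ p)

  path-tail : ∀ {a b c p ps} → Path S a c (b ∷ p ∷ ps) → Path S a p (p ∷ ps) × p ~ c × c ∉ p ∷ ps
  path-tail (extend q e c∉) with refl ← path-head-≡ q = q , e , c∉

  path⊆nodes : ∀ {a b ps} → a ∈ Shape.nodes S → Path S a b ps → ps ⊆ Shape.nodes S
  path⊆nodes a∈ start          (here refl) = a∈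
  path⊆nodes a∈ (extend p e _) (here refl) = ~-node (~-sym e)
  path⊆nodes a∈ (extend p _ _) (there q∈)  = path⊆nodes a∈ p q∈

  path-unique-nodes : ∀ {a b ps} → Path S a b ps → Unique ps
  path-unique-nodes start           = [] ∷ []
  path-unique-nodes (extend p _ c∉) = ¬Any⇒All¬ _ c∉ ∷ path-unique-nodes p

  path-length-≤ : ∀ {a b ps} → a ∈ Shape.nodes S → Path S a b ps → length ps ≤ Shape.size S
  path-length-≤ a∈ p = Unique-⊆⇒length-≤ (path-unique-nodes p) (path⊆nodes a∈ p)

  path-nonempty : ∀ {a b ps} → Path S a b ps → 1 ≤ length ps
  path-nonempty start          = s≤s z≤n
  path-nonempty (extend _ _ _) = s≤s z≤n

  truncate : ∀ {a b c ps} → Path S a b ps → c ∈ ps → ∃[ qs ] Path S a c qs × qs ⊆ ps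
  truncate start            (here refl) = _ , start , id
  truncate p@(extend _ _ _) (here refl) = _ , p , id
  truncate (extend p _ _)   (there c∈) with qs , q , qs⊆ps ← truncate p c∈ = qs , q , there ∘ qs⊆ps

  loop-erase : ∀ {P a b c ps} → Path S a b ps → All P ps → Star (Inside S P) b c →
               ∃[ qs ] Path S a c qs × All P qs
  loop-erase p Pps ε = _ , p , Pps
  loop-erase {ps = ps} p Pps (_◅_ {j = q} (e , _ , Pq) walk) with q ∈? ps
  ... | no  q∉ps = loop-erase (extend p e q∉ps) (Pq ∷ Pps) walk
  ... | yes q∈ps with truncate p q∈ps
  ...   | _ , p′ , qs⊆ps = loop-erase p′ (All.tabulate (All.lookup Pps ∘ qs⊆ps)) walk

  path⇒walk : ∀ {P a b ps} → Path S a b ps → All P ps → Star (Inside S P) a b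
  path⇒walk start          _          = ε
  path⇒walk (extend p e _) (Pc ∷ Pps) =
    path⇒walk p Pps ◅◅ (e , All.lookup Pps (path-end∈ p) , Pc) ◅ ε

  extend-until : ∀ {a} {P Q : Point → List Point → Set} → a ∈ Shape.nodes S →
    (∀ {v ps} → Path S a v ps → P v ps → Q v ps ⊎ ∃[ w ] v ~ w × w ∉ ps × P w (w ∷ ps)) →
    ∀ {v ps} → Path S a v ps → P v ps → ∃[ w ] ∃[ qs ] Path S a w qs × P w qs × Q w qs
  extend-until {a} {P} {Q} a∈ stop-or-extend p = go (Shape.size S) (m<m+n _ (path-nonempty p)) p
    where
    go : ∀ fuel {v ps} → Shape.size S < fuel + length ps → Path S a v ps → P v ps →
         ∃[ w ] ∃[ qs ] Path S a w qs × P w qs × Q w qs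
    go zero       size< p _  = contradiction (path-length-≤ a∈ p) (<⇒≱ size<)
    go (suc fuel) size< p Pp with stop-or-extend p Pp
    ... | inj₁ Qp = _ , _ , p , Pp , Qp
    ... | inj₂ (w , e , w∉ , Pw) =
      go fuel (subst (Shape.size S <_) (sym (+-suc fuel _)) size<) (extend p e w∉) Pw

  module _ {a b before} (base : Path S a b before) (d : Dir) where

    line-head : ∀ x → ∃[ rs ] line b d x ++ before ≡ at b d x ∷ rs
    line-head zero with qs , refl ← path-head base = qs , cong (_∷ qs) (sym (at-zero b d))
    line-head (suc x) = _ , refl

    segments-line-extend : ∀ x → segments (line b d (2 + x) ++ before) ≡
                                 segments (line b d (1 + x) ++ before)
    segments-line-extend x with rs , eq ← line-head x rewrite eq = segments-straight rs straight
      where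
      straight : ¬ Perpendicular (at b d (2 + x)) (at b d (1 + x)) (at b d x)
      straight perp with () ← trans (sym (dot-vec d))
        (trans (sym (dot-corner (at b d x) (vec d) (vec d) (at-suc b d (suc x)) (at-suc b d x))) perp)

    segments-line-suc : ∀ x → segments (line b d (suc x) ++ before) ≡ segments (line b d 1 ++ before)
    segments-line-suc zero    = refl
    segments-line-suc (suc x) = trans (segments-line-extend x) (segments-line-suc x)

    line-tail : ∀ x → Path S a (at b d (suc x)) (line b d (suc x) ++ before) →
                Path S a (at b d x) (line b d x ++ before) × at b d x ~ at b d (suc x)
    line-tail x p with rs , eq ← line-head x
      with p′ , e , _ ← path-tail (subst (λ ps → Path S a _ (_ ∷ ps)) eq p) =
      subst (Path S a _) (sym eq) p′ , e

    line-prefix : ∀ {x y} → y ≤ x → Path S a (at b d x) (line b d x ++ before) →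
                  Path S a (at b d y) (line b d y ++ before)
    line-prefix {x} y≤x p with m≤n⇒m<n∨m≡n y≤x
    ... | inj₂ refl = p
    line-prefix {suc x} _ p | inj₁ (s≤s y≤x) = line-prefix y≤x (proj₁ (line-tail x p))

path-map : ∀ {S T : Shape} → (∀ {p q} → Shape._~_ S p q → Shape._~_ T p q) →
           ∀ {a b ps} → Path S a b ps → Path T a b ps
path-map S⊆T start           = start
path-map S⊆T (extend p e c∉) = extend (path-map S⊆T p) (S⊆T e) c∉

-- Subshapes

record Spans (T : Shape) (P : Pred Point 0ℓ) (S : Shape) : Set where
  constructor spans
  field
    node⇔ : ∀ {p} → p ∈ Shape.nodes S ⇔ P p
    edge⇔ : ∀ {p q} → Shape._~_ S p q ⇔ Inside T P p q

Spans-resp-⇔ : ∀ {T P Q S} → (∀ {v} → P v ⇔ Q v) → Spans T P S → Spans T Q S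
Spans-resp-⇔ P⇔Q (spans node⇔ edge⇔) =
  spans (P⇔Q ⇔-∘ node⇔) ((⇔-id _ ×-⇔ P⇔Q ×-⇔ P⇔Q) ⇔-∘ edge⇔)

Spans-nodes⇒≋ : ∀ {T S} → Spans T (_∈ Shape.nodes T) S → S ≋ T
Spans-nodes⇒≋ {T} (spans node⇔ edge⇔) =
  (λ p → node⇔) , λ p q → mk⇔ (proj₁ ∘ to edge⇔)
    (λ e → from edge⇔ (e , Shape.~-node T e , Shape.~-node T (Shape.~-sym T e)))

IsTree-Spans : ∀ {T P S} → Spans T P S → IsTree T → IsTree S
IsTree-Spans {T} {S = S} (spans _ edge⇔) tree p 3≤ e =
  tree (path-map {S} {T} (proj₁ ∘ to edge⇔) p) 3≤ (proj₁ (to edge⇔ e))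

module _ (T : Shape) {P : Pred Point 0ℓ} (P? : Decidable P) {r : Point}
         (connect : ∀ {v} → P v → Star (Inside T P) r v) where

  open Shape T using (_~?_; ~-node; ~-adjacent)

  induced : Shape
  induced = record
    { nodes      = filter P? (Shape.nodes T)
    ; distinct   = Unique.filter⁺ P? (Shape.distinct T)
    ; _~_        = Inside T P
    ; _~?_       = λ p q → (p ~? q) ×-dec (P? p ×-dec P? q)
    ; ~-sym      = Inside-sym T P
    ; ~-node     = λ (e , Pp , _) → ∈-filter⁺ P? (~-node e) Pp
    ; ~-adjacent = ~-adjacent ∘ proj₁
    ; connected  = λ p∈ q∈ → Star.reverse (Inside-sym T P) (from-root p∈) ◅◅ from-root q∈
    }
    where
    from-root : ∀ {v} → v ∈ filter P? (Shape.nodes T) → Star (Inside T P) r v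
    from-root = connect ∘ proj₂ ∘ ∈-filter⁻ P? {xs = Shape.nodes T}

  Spans-induced : (∀ {v} → P v → v ∈ Shape.nodes T) → Spans T P induced
  Spans-induced P⊆T = spans
    (mk⇔ (proj₂ ∘ ∈-filter⁻ P? {xs = Shape.nodes T}) (λ Pp → ∈-filter⁺ P? (P⊆T Pp) Pp)) (⇔-id _)

displacement-∷ : ∀ {S : Shape} (ops : Operations S) → let open Operations ops in ∀ c p ps →
  (Splits p c × displacement (c ∷ p ∷ ps) ≡ (c ⊖ p) ⊕ displacement (p ∷ ps)) ⊎
  (¬ Splits p c × displacement (c ∷ p ∷ ps) ≡ displacement (p ∷ ps))
displacement-∷ ops c p ps = cases (splits? p c)
  where
  open Operations ops
  conditional : Bool → Point
  conditional b = (if b then c ⊖ p else origin) ⊕ displacement (p ∷ ps)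
  cases : Dec (Splits p c) → (Splits p c × displacement (c ∷ p ∷ ps) ≡ conditional true) ⊎
                             (¬ Splits p c × displacement (c ∷ p ∷ ps) ≡ displacement (p ∷ ps))
  cases (yes splits) = inj₁ (splits , cong conditional (dec-true (splits? p c) splits))
  cases (no ¬splits) =
    inj₂ (¬splits , trans (cong conditional (dec-false (splits? p c) ¬splits)) (⊕-identityˡ _))

-- Trees and their segments

module Tree (T : Shape) (tree : IsTree T) (u₀ : Point) (u₀∈ : u₀ ∈ Shape.nodes T) where

  open Shape T using (_~_; _~?_; ~-sym; ~-node; ~-adjacent)

  RootPath : Point → List Point → Set
  RootPath = Path T u₀

  root-path : ∀ {v} → v ∈ Shape.nodes T → ∃[ ps ] RootPath v ps
  root-path v∈ = Product.map₂ proj₁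
    (loop-erase start (tt ∷ []) (Star.map (λ e → e , tt , tt) (Shape.connected T u₀∈ v∈)))

  root-path⇒node : ∀ {v ps} → RootPath v ps → v ∈ Shape.nodes T
  root-path⇒node p = path⊆nodes u₀∈ p (path-end∈ p)

  root-path-unique : ∀ {v ps qs} → RootPath v ps → RootPath v qs → ps ≡ qs
  root-path-unique start start = refl
  root-path-unique start (extend q _ u₀∉) = contradiction (path-start∈ q) u₀∉
  root-path-unique (extend p _ u₀∉) start = contradiction (path-start∈ p) u₀∉
  root-path-unique {c} (extend {b} {ps = ps} p e c∉ps) (extend {b′} {ps = qs} q e′ c∉qs) with b ≟ b′
  ... | yes refl = cong (c ∷_) (root-path-unique p q)
  ... | no b≢b′ = ⊥-elim (closes-cycle detour)
    where
    detour : ∃[ rs ] Path T b b′ rs × All (c ≢_) rs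
    detour = loop-erase start (All.lookup (¬Any⇒All¬ _ c∉ps) (path-end∈ p) ∷ [])
      (Star.reverse (Inside-sym T (c ≢_)) (path⇒walk p (¬Any⇒All¬ _ c∉ps)) ◅◅
       path⇒walk q (¬Any⇒All¬ _ c∉qs))
    closes-cycle : ∃[ rs ] Path T b b′ rs × All (c ≢_) rs → ⊥
    closes-cycle (_ , start , _) = b≢b′ refl
    closes-cycle (_ , r@(extend r′ _ _) , avoids) with _ , refl ← path-head r′ =
      tree (extend r e′ (All¬⇒¬Any avoids)) (s≤s (s≤s (s≤s z≤n))) (~-sym e)

  Parent : Rel Point 0ℓ
  Parent p c = ∃[ ps ] RootPath p ps × RootPath c (c ∷ ps)

  parent⇒~ : ∀ {p c} → Parent p c → p ~ c
  parent⇒~ (_ , p , c) with _ , refl ← path-head p = proj₁ (proj₂ (path-tail c))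

  parent⇒∉ : ∀ {p c ps} → RootPath p ps → Parent p c → c ∉ ps
  parent⇒∉ p (_ , q , c) with refl ← root-path-unique p q with _ , refl ← path-head p =
    proj₂ (proj₂ (path-tail c))

  parent-asym : ∀ {p c} → Parent p c → ¬ Parent c p
  parent-asym child (_ , c , p) = parent⇒∉ p child (there (path-end∈ c))

  ~⇒parent : ∀ {p q} → p ~ q → Parent p q ⊎ Parent q p
  ~⇒parent {p} {q} e with ps , path ← root-path (~-node e) with q ∈? ps
  ... | no  q∉ps = inj₁ (ps , path , extend path e q∉ps)
  ... | yes q∈ps = inj₂ (earlier-on path q∈ps)
    where
    earlier-on : ∀ {ps} → RootPath p ps → q ∈ ps → Parent q p
    earlier-on start               (here refl) = contradiction e (~-irrefl T)
    earlier-on (extend _ _ _)      (here refl) = contradiction e (~-irrefl T)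
    earlier-on (extend path _ p∉) (there q∈) with qs , path′ , qs⊆ ← truncate path q∈ =
      qs , path′ , extend path′ (~-sym e) (p∉ ∘ qs⊆)

  within⇒node : ∀ {i v} → Within T u₀ i v → v ∈ Shape.nodes T
  within⇒node (_ , p , _) = root-path⇒node p

  within-dist : ∀ {i v ps} → RootPath v ps → Within T u₀ i v → segments ps ≤ i
  within-dist p (_ , q , ≤i) with refl ← root-path-unique p q = ≤i

  ParentClosed : Pred Point 0ℓ → Set
  ParentClosed P = ∀ {p c} → Parent p c → P c → P p

  parent-closed⇒walk : ∀ {P} → ParentClosed P → ∀ {v ps} → RootPath v ps → P v →
                       Star (Inside T P) u₀ v
  parent-closed⇒walk {P} closed p Pv = path⇒walk p (all p Pv)
    where
    all : ∀ {v ps} → RootPath v ps → P v → All P ps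
    all start               Pv = Pv ∷ []
    all path@(extend p _ _) Pv = Pv ∷ all p (closed (_ , p , path) Pv)

  parent-segments-≤ : ∀ {p c ps} → RootPath p ps → RootPath c (c ∷ ps) →
                      segments ps ≤ segments (c ∷ ps)
  parent-segments-≤ {p} {c} path _ with qs , refl ← path-head path = segments-mono c p qs

  extend-to-leaf : ∀ {v ps} → RootPath v ps →
                   ∃[ w ] ∃[ qs ] RootToLeaf T u₀ w qs × segments ps ≤ segments qs
  extend-to-leaf {ps = ps} p = leaf (extend-until u₀∈ leaf-or-child p ≤-refl)
    where
    Childless : Point → List Point → Set
    Childless v qs = ∀ w → v ~ w → w ∈ qs
    leaf-or-child : ∀ {v qs} → RootPath v qs → segments ps ≤ segments qs →
                    Childless v qs ⊎ ∃[ w ] v ~ w × w ∉ qs × segments ps ≤ segments (w ∷ qs)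
    leaf-or-child {v} {qs} q ≤q with any? (λ w → (v ~? w) ×-dec ¬? (w ∈? qs)) (Shape.nodes T)
    ... | yes child with w , _ , e , w∉ ← find child =
      inj₂ (w , e , w∉ , ≤-trans ≤q (parent-segments-≤ q (extend q e w∉)))
    ... | no childless = inj₁ λ w e →
      decidable-stable (w ∈? qs) λ w∉ → childless (lose (~-node (~-sym e)) (e , w∉))
    leaf : ∃[ w ] ∃[ qs ] RootPath w qs × segments ps ≤ segments qs × Childless w qs →
           ∃[ w ] ∃[ qs ] RootToLeaf T u₀ w qs × segments ps ≤ segments qs
    leaf (w , qs , q , ≤q , childless) = w , qs , (q , childless) , ≤q

  segments-≤ : ∀ {n} → (∀ {v ps} → RootToLeaf T u₀ v ps → segments ps ≤ n) →
               ∀ {v ps} → RootPath v ps → segments ps ≤ n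
  segments-≤ bound p with _ , _ , leaf , ≤leaf ← extend-to-leaf p = ≤-trans ≤leaf (bound leaf)

  data LastSegment : Point → List Point → Set where
    none    : LastSegment u₀ (u₀ ∷ [])
    ends-in : ∀ {b before} d x → RootPath b before → StartsSegment b d before →
              LastSegment (at b d (suc x)) (line b d (suc x) ++ before)

  last-segment : ∀ {v ps} → RootPath v ps → LastSegment v ps
  last-segment start = none
  last-segment (extend {p} {c} {ps} path e c∉) with adjacent⇒at p c (~-adjacent e) | last-segment path
  ... | d , refl | none = ends-in d 0 start refl
  ... | d , refl | ends-in {b} {before} d′ x base starts
    with rs , eq ← line-head base d′ x | angle d d′
  ...   | same refl =
    subst (λ c → LastSegment c (c ∷ ps)) (at-suc-at b d (suc x)) (ends-in d (suc x) base starts)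
  ...   | opposite opp = contradiction (there (subst (_ ∈_) (sym eq) (here back))) c∉
    where
    open ≡-Reasoning
    back : at p d 1 ≡ at b d′ x
    back = begin
      at p d 1                       ≡⟨ cong₂ _⊕_ (at-suc b d′ x) (•-identityˡ (vec d)) ⟩
      at b d′ x ⊕ vec d′ ⊕ vec d     ≡⟨ ⊕-assoc (at b d′ x) (vec d′) (vec d) ⟩
      at b d′ x ⊕ (vec d′ ⊕ vec d)   ≡⟨ cong (at b d′ x ⊕_) opp ⟩
      at b d′ x ⊕ origin             ≡⟨ ⊕-identityʳ (at b d′ x) ⟩
      at b d′ x                      ∎
  ...   | perpendicular perp = ends-in d 0 path turns
    where
    turns : StartsSegment p d (line b d′ (suc x) ++ before)
    turns rewrite eq = segments-turn rs
      (trans (dot-corner (at b d′ x) (vec d) (vec d′) (at-one p d) (at-suc b d′ x)) perp)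

  module _ {i b d m} (s : Segment T u₀ i b d m) where

    open Segment s using (before; nonempty; path-to-base; path-to-end; end-dist)

    segment-path : ∀ {x} → x ≤ m → RootPath (at b d x) (line b d x ++ before)
    segment-path x≤m = line-prefix path-to-base d x≤m path-to-end

    segment-edge : ∀ {x} → x < m → at b d x ~ at b d (suc x)
    segment-edge {x} x<m = proj₂ (line-tail path-to-base d x (segment-path x<m))

    segment-parent : ∀ {x} → x < m → Parent (at b d x) (at b d (suc x))
    segment-parent x<m = _ , segment-path (<⇒≤ x<m) , segment-path x<m

    segment-dist : ∀ x → segments (line b d (suc x) ++ before) ≡ i
    segment-dist x = trans (segments-line-suc path-to-base d x) (first-step nonempty end-dist)
      where
      first-step : ∀ {m} → 1 ≤ m → segments (line b d m ++ before) ≡ i →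
                   segments (line b d 1 ++ before) ≡ i
      first-step {suc m} _ eq = trans (sym (segments-line-suc path-to-base d m)) eq

  segment-parent-unique : ∀ {i b d m x p} → Segment T u₀ i b d m → x < m →
                          Parent p (at b d (suc x)) → p ≡ at b d x
  segment-parent-unique s x<m (_ , p , c) with refl ← root-path-unique c (segment-path s x<m) =
    path-end-unique p (segment-path s (<⇒≤ x<m))

  segment-len-unique : ∀ {i i′ b d m m′} → Segment T u₀ i b d m → Segment T u₀ i′ b d m′ → m ≡ m′
  segment-len-unique {m = m} {m′} s s′ with <-cmp m m′
  ... | tri< m<m′ _ _ = contradiction (segment-edge s′ m<m′) (Segment.maximal s)
  ... | tri≈ _ m≡m′ _ = m≡m′
  ... | tri> _ _ m>m′ = contradiction (segment-edge s m>m′) (Segment.maximal s′)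

  segment-offset-unique : ∀ {i b b′ d m m′} (s : Segment T u₀ i b d m) (s′ : Segment T u₀ i b′ d m′) →
    ∀ x x′ → line b d x ++ Segment.before s ≡ line b′ d x′ ++ Segment.before s′ → x ≡ x′
  segment-offset-unique s s′ zero    zero     _  = refl
  segment-offset-unique s s′ zero    (suc x′) eq = contradiction
    (trans (Segment.base-dist s) (trans (sym (segment-dist s′ x′)) (cong segments (sym eq)))) 1+n≢n
  segment-offset-unique s s′ (suc x) zero     eq = contradiction
    (trans (Segment.base-dist s′) (trans (sym (segment-dist s x)) (cong segments eq))) 1+n≢n
  segment-offset-unique s s′ (suc x) (suc x′) eq =
    cong suc (segment-offset-unique s s′ x x′ (∷-injectiveʳ eq))

  segment-unique : ∀ {i b b′ d m m′ x x′} → Segment T u₀ i b d m → Segment T u₀ i b′ d m′ →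
    x ≤ m → x′ ≤ m′ → at b d x ≡ at b′ d x′ → x ≡ x′ × b ≡ b′ × m ≡ m′
  segment-unique {b = b} {b′} {d} {x = x} {x′} s s′ x≤m x′≤m′ eq
    with refl ← segment-offset-unique s s′ x x′ (root-path-unique (segment-path s x≤m)
      (subst (λ p → RootPath p (line b′ d x′ ++ Segment.before s′)) (sym eq) (segment-path s′ x′≤m′)))
    with refl ← ⊕-cancelʳ (x • vec d) b b′ eq = refl , refl , segment-len-unique s s′

  -- The base is left out, as it also lies on the preceding segment: every node
  -- other than the root is on exactly one segment.
  data OnSegment (i : ℕ) (d : Dir) (v : Point) : Set where
    on : ∀ {b m} (s : Segment T u₀ i b d m) x → x < m → v ≡ at b d (suc x) → OnSegment i d v

  on-segment-dist : ∀ {i d v ps} → RootPath v ps → OnSegment i d v → segments ps ≡ i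
  on-segment-dist p (on s x x<m refl) with refl ← root-path-unique p (segment-path s x<m) =
    segment-dist s x

  on-segment-dir : ∀ {i i′ d d′ v} → OnSegment i d v → OnSegment i′ d′ v → d ≡ d′
  on-segment-dir {d = d} {d′} (on {b} s x x<m refl) (on {b′} s′ x′ x′<m′ eq) =
    vec-injective (⊕-cancelˡ (at b′ d′ x′) (vec d) (vec d′) (begin
      at b′ d′ x′ ⊕ vec d     ≡⟨ cong (_⊕ vec d) same-parent ⟩
      at b d x ⊕ vec d        ≡⟨ at-suc b d x ⟨
      at b d (suc x)          ≡⟨ eq ⟩
      at b′ d′ (suc x′)       ≡⟨ at-suc b′ d′ x′ ⟩
      at b′ d′ x′ ⊕ vec d′    ∎))
    where
    open ≡-Reasoning
    same-parent : at b′ d′ x′ ≡ at b d x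
    same-parent = segment-parent-unique s x<m (subst (Parent _) (sym eq) (segment-parent s′ x′<m′))

  on-segment-parent : ∀ {i d p c} → Parent p c → OnSegment i d c →
    OnSegment i d p ⊎ ∃[ ps ] RootPath p ps × suc (segments ps) ≡ i
  on-segment-parent child (on s x x<m refl) with refl ← segment-parent-unique s x<m child with x
  ... | zero   = inj₂ (_ , segment-path s z≤n , Segment.base-dist s)
  ... | suc x′ = inj₁ (on s x′ (<⇒≤ x<m) refl)

  -- The continuation of a segment is a new node: the only neighbour of its
  -- current end that has been visited is the parent, one step behind.
  continuation-unvisited : ∀ {b before d y} → RootPath b before →
    RootPath (at b d (suc y)) (line b d (suc y) ++ before) →
    at b d (suc y) ~ at b d (2 + y) → at b d (2 + y) ∉ line b d (suc y) ++ before
  continuation-unvisited {b} {before} {d} {y} base p e visited with ~⇒parent e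
  ... | inj₁ child = parent⇒∉ p child visited
  ... | inj₂ (_ , q , r) with refl ← root-path-unique r p =
    contradiction (at-injective b d (2 + y) y (path-end-unique q (proj₁ (line-tail base d y p))))
                  (>⇒≢ (m<n+m y (s≤s z≤n)))

  complete-segment : ∀ {b before d x} → RootPath b before → StartsSegment b d before →
    RootPath (at b d (suc x)) (line b d (suc x) ++ before) →
    OnSegment (suc (segments before)) d (at b d (suc x))
  complete-segment {b} {before} {d} {x} base starts p =
    segment (extend-until u₀∈ end-or-next p (x , ≤-refl , refl , refl))
    where
    Extended Ended : Point → List Point → Set
    Extended v ps = ∃[ y ] x ≤ y × v ≡ at b d (suc y) × ps ≡ line b d (suc y) ++ before
    Ended    v _  = ¬ v ~ at v d 1
    end-or-next : ∀ {v ps} → RootPath v ps → Extended v ps →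
                  Ended v ps ⊎ ∃[ w ] v ~ w × w ∉ ps × Extended w (w ∷ ps)
    end-or-next p (y , x≤y , refl , refl) with at b d (suc y) ~? at b d (2 + y)
    ... | no  ¬e = inj₁ (¬e ∘ subst (at b d (suc y) ~_) (sym (at-suc-at b d (suc y))))
    ... | yes e  = inj₂
      (at b d (2 + y) , e , continuation-unvisited base p e , suc y , m≤n⇒m≤1+n x≤y , refl , refl)
    segment : ∃[ w ] ∃[ qs ] RootPath w qs × Extended w qs × Ended w qs →
              OnSegment (suc (segments before)) d (at b d (suc x))
    segment (_ , _ , q , (y , x≤y , refl , refl) , ended) = on (record
      { nonempty     = s≤s z≤n
      ; before       = before
      ; path-to-base = base
      ; path-to-end  = q
      ; base-dist    = refl
      ; end-dist     = trans (segments-line-suc base d y) starts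
      ; maximal      = ended ∘ subst (at b d (suc y) ~_) (at-suc-at b d (suc y))
      }) x (s≤s x≤y) refl

  data Location (v : Point) (ps : List Point) : Set where
    at-root    : segments ps ≡ 0 → Location v ps
    on-segment : ∀ {d} → OnSegment (segments ps) d v → Location v ps

  locate : ∀ {v ps} → RootPath v ps → Location v ps
  locate p with last-segment p
  ... | none = at-root refl
  ... | ends-in {b} d x base starts = on-segment
    (subst (λ i → OnSegment i d (at b d (suc x))) (sym (trans (segments-line-suc base d x) starts))
      (complete-segment base starts p))

  on-segment-dist>0 : ∀ {i d v} → OnSegment i d v → 0 < i
  on-segment-dist>0 (on s _ _ _) = subst (0 <_) (Segment.base-dist s) (s≤s z≤n)

  on-segment-child : ∀ {i d p c} → Parent p c → OnSegment i d p → Within T u₀ i c → OnSegment i d c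
  on-segment-child {c = v} child@(_ , p , c) p-on c-within with locate c
  ... | at-root seg≡0 = contradiction (on-segment-dist>0 p-on)
    (≤⇒≯ (subst₂ _≤_ (on-segment-dist p p-on) seg≡0 (parent-segments-≤ p c)))
  ... | on-segment {d} c-on with on-segment-parent child c-on
  ...   | inj₁ p-on′ with refl ← on-segment-dir p-on p-on′ =
    subst (λ i → OnSegment i d v)
      (trans (sym (on-segment-dist p p-on′)) (on-segment-dist p p-on)) c-on
  ...   | inj₂ (_ , q , base-dist) with refl ← root-path-unique p q =
    contradiction (within-dist c c-within)
      (<⇒≱ (≤-reflexive (trans (cong suc (sym (on-segment-dist p p-on))) base-dist)))

  segment-base-off : ∀ {i b d m} → Segment T u₀ i b d m → ¬ OnSegment i d (at b d 0)
  segment-base-off s (on s′ x x<m eq) with () , _ ← segment-unique s s′ z≤n x<m eq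

  on-some-segment? : ∀ i → Decidable (λ v → ∃[ d ] OnSegment i d v)
  on-some-segment? i v with v ∈? Shape.nodes T
  ... | no v∉ = no λ { (_ , on s x x<m refl) → v∉ (root-path⇒node (segment-path s x<m)) }
  ... | yes v∈ with ps , p ← root-path v∈ with locate p
  ...   | at-root seg≡0 = no λ (_ , o) →
    <⇒≢ (on-segment-dist>0 o) (trans (sym seg≡0) (on-segment-dist p o))
  ...   | on-segment o =
    map′ (λ { refl → _ , o }) (λ (_ , o′) → on-segment-dist p o′) (segments ps ℕ.≟ i)

  on-segment? : ∀ i d → Decidable (OnSegment i d)
  on-segment? i d v with on-some-segment? i v
  ... | no ¬o       = no (¬o ∘ (d ,_))
  ... | yes (e , o) = map′ (λ { refl → o }) (on-segment-dir o) (e ≟ᵈ d)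

  data ChildView (i : ℕ) (d : Dir) (p c : Point) : Set where
    along : ∀ {b m} (s : Segment T u₀ i b d m) x → x < m →
            p ≡ at b d x → c ≡ at b d (suc x) → ChildView i d p c
    apart : ¬ OnSegment i d p → ¬ OnSegment i d c → ChildView i d p c

  childView : ∀ {i p c} d → Parent p c → Within T u₀ i c → ChildView i d p c
  childView {i} {c = c} d child c-within with on-segment? i d c
  ... | yes (on s x x<m refl) = along s x x<m (segment-parent-unique s x<m child) refl
  ... | no c-off              = apart (λ p-on → c-off (on-segment-child child p-on c-within)) c-off

  data Reached (i : ℕ) (cap : Dir → ℕ) (v : Point) : Set where
    earlier : ∀ {ps} → RootPath v ps → segments ps < i → Reached i cap v
    current : ∀ {b d m} (s : Segment T u₀ i b d m) x → x < m → x < cap d →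
              v ≡ at b d (suc x) → Reached i cap v

  reached⇒within : ∀ {i cap v} → Reached i cap v → Within T u₀ i v
  reached⇒within (earlier p <i)           = _ , p , <⇒≤ <i
  reached⇒within (current s x x<m _ refl) = _ , segment-path s x<m , ≤-reflexive (segment-dist s x)

  segment-reached : ∀ {i b d m x cap} → Segment T u₀ i b d m → x ≤ m → x ≤ cap d →
                    Reached i cap (at b d x)
  segment-reached {x = zero}  s 0≤m _     =
    earlier (segment-path s 0≤m) (≤-reflexive (Segment.base-dist s))
  segment-reached {x = suc x} s x<m x<cap = current s x x<m x<cap refl

  reached-offset : ∀ {i b d m x cap} → Segment T u₀ i b d m → x ≤ m →
                   Reached i cap (at b d x) → x ≤ cap d
  reached-offset {x = zero}  _ _   _ = z≤n
  reached-offset {x = suc x} s x<m (earlier p <i) =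
    contradiction (on-segment-dist p (on s x x<m refl)) (<⇒≢ <i)
  reached-offset {x = suc x} s x<m (current s′ x′ x′<m′ x′<cap eq)
    with refl ← on-segment-dir (on s x x<m refl) (on s′ x′ x′<m′ eq)
    with refl , _ ← segment-unique s s′ x<m x′<m′ eq = x′<cap

  reached? : ∀ i cap → Decidable (Reached i cap)
  reached? i cap v with v ∈? Shape.nodes T
  ... | no  v∉ = no (v∉ ∘ within⇒node ∘ reached⇒within)
  ... | yes v∈ with ps , p ← root-path v∈ with segments ps <? i | on-some-segment? i v
  ...   | yes <i | _ = yes (earlier p <i)
  ...   | no  ≮i | yes (d , on s x x<m refl) =
    map′ (λ x<cap → current s x x<m x<cap refl) (reached-offset s x<m) (x <? cap d)
  ...   | no  ≮i | no v-off = no λ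
    { (earlier q <i)           → ≮i (subst (λ qs → segments qs < i) (root-path-unique q p) <i)
    ; (current s x x<m _ v≡) → v-off (_ , on s x x<m v≡) }

  reached-off-dir : ∀ {i d cap cap′ v} → (∀ {e} → e ≢ d → cap e ≡ cap′ e) → ¬ OnSegment i d v →
                    Reached i cap v → Reached i cap′ v
  reached-off-dir agree v-off (earlier p <i) = earlier p <i
  reached-off-dir {d = d} agree v-off (current {d = e} s x x<m x<cap refl) with e ≟ᵈ d
  ... | yes refl = contradiction (on s x x<m refl) v-off
  ... | no  e≢d  = current s x x<m (subst (x <_) (agree e≢d) x<cap) refl

  reached-parent-closed : ∀ i cap → ParentClosed (Reached i cap)
  reached-parent-closed i cap (ps , p , c) (earlier q <i) with refl ← root-path-unique c q =
    earlier p (≤-<-trans (parent-segments-≤ p c) <i)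
  reached-parent-closed i cap child (current s x x<m x<cap refl)
    with refl ← segment-parent-unique s x<m child =
    segment-reached s (<⇒≤ x<m) (<⇒≤ x<cap)

  within⇔unstarted : ∀ {i v} → Within T u₀ i v ⇔ Reached (suc i) (const 0) v
  within⇔unstarted = mk⇔
    (λ { (_ , p , ≤i) → earlier p (s≤s ≤i) })
    (λ { (earlier p <1+i) → _ , p , m<1+n⇒m≤n <1+i ; (current _ _ _ () _) })

  segment-len-<size : ∀ {i b d m} → Segment T u₀ i b d m → m < Shape.size T
  segment-len-<size {b = b} {d} {m} s = begin-strict
    m                                      <⟨ m<m+n m (path-nonempty path-to-base) ⟩
    m + length before                      ≡⟨ cong (_+ length before) (length-line b d m) ⟨
    length (line b d m) + length before    ≡⟨ length-++ (line b d m) ⟨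
    length (line b d m ++ before)          ≤⟨ path-length-≤ u₀∈ path-to-end ⟩
    Shape.size T                           ∎
    where
    open ≤-Reasoning
    open Segment s using (before; path-to-base; path-to-end)

  reached⇔within : ∀ {i cap v} → 0 < i → (∀ d → Shape.size T ≤ suc (cap d)) →
                   Reached i cap v ⇔ Within T u₀ i v
  reached⇔within {i} {cap} {v} 0<i size≤ = mk⇔ reached⇒within reached
    where
    reached : Within T u₀ i v → Reached i cap v
    reached (ps , p , ≤i) with m≤n⇒m<n∨m≡n ≤i | locate p
    ... | inj₁ <i   | _ = earlier p <i
    ... | inj₂ refl | at-root seg≡0 = contradiction (sym seg≡0) (<⇒≢ 0<i)
    ... | inj₂ refl | on-segment {d} (on s x x<m v≡) =
      current s x x<m (<-≤-trans x<m (m<1+n⇒m≤n (<-≤-trans (segment-len-<size s) (size≤ d)))) v≡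

  reached-connected : ∀ {i cap v} → Reached i cap v → Star (Inside T (Reached i cap)) u₀ v
  reached-connected {i} {cap} r with _ , p , _ ← reached⇒within r =
    parent-closed⇒walk (reached-parent-closed i cap) p r

  stage : ℕ → (Dir → ℕ) → Shape
  stage i cap = induced T (reached? i cap) reached-connected

  spans-stage : ∀ i cap → Spans T (Reached i cap) (stage i cap)
  spans-stage i cap = Spans-induced T (reached? i cap) reached-connected (within⇒node ∘ reached⇒within)

  -- One step of a phase

  module Doubling (j : ℕ) (d : Dir) (cap : Dir → ℕ) where

    private
      i w : ℕ
      i = suc j
      w = cap d
      cap′ : Dir → ℕ
      cap′ = double d cap

    Movable : Pred Point 0ℓ
    Movable = OnSegment i d

    segment-reached-after : ∀ {b m x} → Segment T u₀ i b d m → x ≤ m → x ≤ suc (w + w) →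
                            Reached i cap′ (at b d x)
    segment-reached-after s x≤m x≤double =
      segment-reached s x≤m (≤-trans x≤double (≤-reflexive (sym (double-same d cap))))

    reached-offset-after : ∀ {b m x} → Segment T u₀ i b d m → x ≤ m →
                           Reached i cap′ (at b d x) → x ≤ suc (w + w)
    reached-offset-after s x≤m r = ≤-trans (reached-offset s x≤m r) (≤-reflexive (double-same d cap))

    data Op (u : Point) : Set where
      op : ∀ {b m} (s : Segment T u₀ i b d m) y → y < quota w m → u ≡ at b d y → Op u

    op⇒<quota : ∀ {b m x} → Segment T u₀ i b d m → x ≤ m → Op (at b d x) → x < quota w m
    op⇒<quota {m = m} s x≤m (op {m = m′} s′ y y<μ eq)
      with refl , _ , refl ← segment-unique s s′ x≤m (<quota⇒≤len w m′ y<μ) eq = y<μ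

    op⇒movable : ∀ {u} → Op u → Movable (u ⊕ vec d)
    op⇒movable (op {b} {m} s y y<μ refl) = on s y (<quota⇒<len w m y<μ) (sym (at-suc b d y))

    op? : Decidable Op
    op? u with on-segment? i d (u ⊕ vec d)
    ... | no fixed = no (fixed ∘ op⇒movable)
    ... | yes (on {b} {m} s x x<m eq)
      with refl ← ⊕-cancelʳ (vec d) u (at b d x) (trans eq (at-suc b d x)) =
      map′ (λ x<μ → op s x x<μ refl) (op⇒<quota s (<⇒≤ x<m)) (x <? quota w m)

    op-reached : ∀ {u} → Op u → Reached i cap u
    op-reached (op {m = m} s y y<μ refl) = segment-reached s (<quota⇒≤len w m y<μ) (<quota⇒≤ w m y<μ)

    op⇒parent : ∀ {u} → Op u → Parent u (u ⊕ vec d)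
    op⇒parent (op {b} {m} s y y<μ refl) =
      subst (Parent _) (at-suc b d y) (segment-parent s (<quota⇒<len w m y<μ))

    shift : Point → ℕ
    shift v with on-segment? i d v
    ... | yes (on {m = m} s x _ _) = suc x ⊓ quota w m
    ... | no _                     = 0

    shift-fixed : ∀ {v} → ¬ Movable v → shift v ≡ 0
    shift-fixed {v} fixed with on-segment? i d v
    ... | yes movable = contradiction movable fixed
    ... | no  _     = refl

    shift-segment : ∀ {b m x} → Segment T u₀ i b d m → x ≤ m → shift (at b d x) ≡ x ⊓ quota w m
    shift-segment {x = zero} s _ = shift-fixed (segment-base-off s)
    shift-segment {b} {m} {suc x} s x<m with on-segment? i d (at b d (suc x))
    ... | no fixed = contradiction (on s x x<m refl) fixed
    ... | yes (on s′ x′ x′<m′ eq) with refl , _ , refl ← segment-unique s s′ x<m x′<m′ eq = refl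

    move : Point → Point
    move v = at v d (shift v)

    move-fixed : ∀ {v} → ¬ Movable v → move v ≡ v
    move-fixed {v} fixed = trans (cong (at v d) (shift-fixed fixed)) (at-zero v d)

    move-segment : ∀ {b m x} → Segment T u₀ i b d m → x ≤ m →
                   move (at b d x) ≡ at b d (stretch (quota w m) x)
    move-segment {b} {m} {x} s x≤m =
      trans (cong (at (at b d x) d) (shift-segment s x≤m)) (at-+ b d x (x ⊓ quota w m))

    move-segment-suc-< : ∀ {b m y} → Segment T u₀ i b d m → y < quota w m →
                         move (at b d (suc y)) ≡ at b d (2 + stretch (quota w m) y)
    move-segment-suc-< {b} {m} s y<μ =
      trans (move-segment s (<quota⇒<len w m y<μ)) (cong (at b d) (stretch-suc-< y<μ))

    move-segment-suc-≮ : ∀ {b m x} → Segment T u₀ i b d m → x < m → ¬ x < quota w m →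
                         move (at b d (suc x)) ≡ at b d (suc (stretch (quota w m) x))
    move-segment-suc-≮ {b} s x<m x≮μ = trans (move-segment s x<m) (cong (at b d) (stretch-suc-≮ x≮μ))

    move-new : ∀ {b m y} → Segment T u₀ i b d m → y < quota w m →
               move (at b d y) ⊕ vec d ≡ at b d (suc (stretch (quota w m) y))
    move-new {b} {m} {y} s y<μ = trans (cong (_⊕ vec d) (move-segment s (<quota⇒≤len w m y<μ)))
                                       (sym (at-suc b d (stretch (quota w m) y)))

    module _ {S S′ : Shape} (S-spans : Spans T (Reached i cap) S)
             (S′-spans : Spans T (Reached i cap′) S′) where

      open Spans S-spans
      open Spans S′-spans renaming (node⇔ to node′⇔; edge⇔ to edge′⇔)

      ops : Operations S
      ops = record { dir = d ; Op = Op ; op? = op? ; op∈ = from node⇔ ∘ op-reached }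

      open Operations ops hiding (dir; Op; op?; op∈)

      splits⇒toward : ∀ {p c} → Parent p c → Splits p c → Toward p c
      splits⇒toward child (inj₁ toward)      = toward
      splits⇒toward child (inj₂ (o , refl)) = contradiction (op⇒parent o) (parent-asym child)

      toward⇒movable : ∀ {p c} → Toward p c → Movable c
      toward⇒movable (o , refl) = op⇒movable o

      segment-toward : ∀ {b m x} → Segment T u₀ i b d m → x < quota w m →
                       Toward (at b d x) (at b d (suc x))
      segment-toward {b} {x = x} s x<μ = op s x x<μ refl , at-suc b d x

      fixed-¬splits : ∀ {p c} → Parent p c → ¬ Movable c → ¬ Splits p c
      fixed-¬splits child fixed = fixed ∘ toward⇒movable ∘ splits⇒toward child

      segment-¬splits : ∀ {b m x} → Segment T u₀ i b d m → x < m → ¬ x < quota w m →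
                        ¬ Splits (at b d x) (at b d (suc x))
      segment-¬splits s x<m x≮μ splits =
        x≮μ (op⇒<quota s (<⇒≤ x<m) (proj₁ (splits⇒toward (segment-parent s x<m) splits)))

      shift-toward : ∀ {p c} → Toward p c → shift c ≡ suc (shift p)
      shift-toward (op {b} {m} s y y<μ refl , refl) = begin
        shift (at b d y ⊕ vec d)      ≡⟨ cong shift (at-suc b d y) ⟨
        shift (at b d (suc y))        ≡⟨ shift-segment s y<m ⟩
        suc y ⊓ quota w m             ≡⟨ suc-⊓-< y<μ ⟩
        suc (y ⊓ quota w m)           ≡⟨ cong suc (shift-segment s (<⇒≤ y<m)) ⟨
        suc (shift (at b d y))        ∎
        where
        open ≡-Reasoning
        y<m : y < m
        y<m = <quota⇒<len w m y<μ

      shift-¬splits : ∀ {p c} → Parent p c → Within T u₀ i c → ¬ Splits p c → shift c ≡ shift p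
      shift-¬splits child c-within ¬splits with childView d child c-within
      ... | apart p-fixed c-fixed = trans (shift-fixed c-fixed) (sym (shift-fixed p-fixed))
      ... | along {b} {m} s x x<m refl refl = begin
        shift (at b d (suc x))   ≡⟨ shift-segment s x<m ⟩
        suc x ⊓ quota w m        ≡⟨ suc-⊓-≮ (λ x<μ → ¬splits (inj₁ (segment-toward s x<μ))) ⟩
        x ⊓ quota w m            ≡⟨ shift-segment s (<⇒≤ x<m) ⟨
        shift (at b d x)         ∎
        where open ≡-Reasoning

      toTree : ∀ {a b ps} → Path S a b ps → Path T a b ps
      toTree = path-map {S} {T} (proj₁ ∘ to edge⇔)

      displacement-shift : ∀ {v ps} → Path S u₀ v ps → displacement ps ≡ shift v • vec d
      displacement-shift start =
        cong (_• vec d) (sym (shift-fixed λ movable → 0≢1+n (on-segment-dist start movable)))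
      displacement-shift path@(extend {p} {c} path′ e _)
        with qs , refl ← path-head path′ with displacement-∷ ops c p qs
      ... | inj₁ (splits , displaced) = begin
        displacement (c ∷ p ∷ qs)           ≡⟨ displaced ⟩
        (c ⊖ p) ⊕ displacement (p ∷ qs)     ≡⟨ cong₂ _⊕_ c⊖p≡d (displacement-shift path′) ⟩
        vec d ⊕ shift p • vec d             ≡⟨ suc-• (shift p) (vec d) ⟨
        suc (shift p) • vec d               ≡⟨ cong (_• vec d) (shift-toward toward) ⟨
        shift c • vec d                     ∎
        where
        open ≡-Reasoning
        toward : Toward p c
        toward = splits⇒toward (_ , toTree path′ , toTree path) splits
        c⊖p≡d : c ⊖ p ≡ vec d
        c⊖p≡d = trans (cong (_⊖ p) (proj₂ toward)) ([p⊕v]⊖p≡v p (vec d))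
      ... | inj₂ (¬splits , displaced) = begin
        displacement (c ∷ p ∷ qs)           ≡⟨ displaced ⟩
        displacement (p ∷ qs)               ≡⟨ displacement-shift path′ ⟩
        shift p • vec d                     ≡⟨ cong (_• vec d) unshifted ⟨
        shift c • vec d                     ∎
        where
        open ≡-Reasoning
        c-within : Within T u₀ i c
        c-within = reached⇒within (proj₂ (proj₂ (to edge⇔ e)))
        unshifted : shift c ≡ shift p
        unshifted = shift-¬splits (_ , toTree path′ , toTree path) c-within ¬splits

      shiftBody : Body → ℕ
      shiftBody (old v) = shift v
      shiftBody (new u) = suc (shift u)

      shift≤shiftBody : ∀ x → shift (initial x) ≤ shiftBody x
      shift≤shiftBody (old v) = ≤-refl
      shift≤shiftBody (new u) = n≤1+n _

      final-at : ∀ x → final move x ≡ at (initial x) d (shiftBody x)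
      final-at (old v) = refl
      final-at (new u) = sym (at-suc u d (shift u))

      body-unique : ∀ x y → initial x ≡ initial y → shiftBody x ≡ shiftBody y → x ≡ y
      body-unique (old _) (old _) refl _  = refl
      body-unique (new _) (new _) refl _  = refl
      body-unique (old _) (new _) refl eq = contradiction (sym eq) 1+n≢n
      body-unique (new _) (old _) refl eq = contradiction eq 1+n≢n

      data BodyView (x : Body) : Set where
        still     : Reached i cap (initial x) → ¬ Movable (initial x) → shiftBody x ≡ 0 → BodyView x
        advancing : ∀ {b m} (s : Segment T u₀ i b d m) z → initial x ≡ at b d z → z ≤ w → z ≤ m →
                    shiftBody x ≤ quota w m → shiftBody x ≤ suc z → BodyView x

      bodyView : ∀ x → Present x → BodyView x
      bodyView (old v) v∈ with on-segment? i d v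
      ... | no fixed = still (to node⇔ v∈) fixed (shift-fixed fixed)
      ... | yes (on {m = m} s x x<m refl) =
        advancing s (suc x) refl (reached-offset s x<m (to node⇔ v∈)) x<m
          (≤-trans (≤-reflexive (shift-segment s x<m)) (m⊓n≤n (suc x) (quota w m)))
          (≤-trans (≤-reflexive (shift-segment s x<m)) (m≤n⇒m≤1+n (m⊓n≤m (suc x) (quota w m))))
      bodyView (new u) (op {b} {m} s y y<μ refl) = advancing s y refl (<quota⇒≤ w m y<μ) y≤m
        (≤-trans (≤-reflexive (cong suc shift≡y)) y<μ) (≤-reflexive (cong suc shift≡y))
        where
        y≤m : y ≤ m
        y≤m = <quota⇒≤len w m y<μ
        shift≡y : shift (at b d y) ≡ y
        shift≡y = trans (shift-segment s y≤m) (m≤n⇒m⊓n≡m (<⇒≤ y<μ))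

      final-reached : ∀ x → Present x → Reached i cap′ (final move x)
      final-reached x px with bodyView x px
      ... | still reached fixed unshifted = subst (Reached i cap′) (sym final≡)
        (reached-off-dir (sym ∘ double-other d cap) fixed reached)
        where
        final≡ : final move x ≡ initial x
        final≡ = trans (final-at x) (trans (cong (at (initial x) d) unshifted) (at-zero (initial x) d))
      ... | advancing {b} {m} s z initial≡ z≤w z≤m ≤μ _ = subst (Reached i cap′) (sym final≡)
        (segment-reached-after s (≤quota⇒+≤len w m z≤w z≤m ≤μ) (≤quota⇒+≤double w m z≤w ≤μ))
        where
        final≡ : final move x ≡ at b d (z + shiftBody x)
        final≡ = trans (final-at x) (at-beyond b d z (shiftBody x) initial≡)

      shiftBody-≤-ahead : ∀ x → Present x → ∀ t → suc t ≤ shiftBody x →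
                          shiftBody x ≤ shift (at (initial x) d (suc t))
      shiftBody-≤-ahead x px t t< with bodyView x px
      ... | still _ _ unshifted = contradiction (≤-trans t< (≤-reflexive unshifted)) λ ()
      ... | advancing {b} {m} s z initial≡ z≤w z≤m ≤μ ≤1+z = begin
        shiftBody x                          ≤⟨ ⊓-glb ≤1+z ≤μ ⟩
        suc z ⊓ quota w m                    ≤⟨ ⊓-monoˡ-≤ (quota w m) (m<m+n z (s≤s z≤n)) ⟩
        (z + suc t) ⊓ quota w m              ≡⟨ shift-segment s z+1+t≤m ⟨
        shift (at b d (z + suc t))           ≡⟨ cong shift (at-beyond b d z (suc t) initial≡) ⟨
        shift (at (initial x) d (suc t))     ∎
        where
        open ≤-Reasoning
        z+1+t≤m : z + suc t ≤ m
        z+1+t≤m = ≤quota⇒+≤len w m z≤w z≤m (≤-trans t< ≤μ)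

      ¬overtakes : ∀ x y → Present x →
                   ¬ Overtakes d (initial x) (shiftBody x) (initial y) (shiftBody y)
      ¬overtakes x y px (t , ahead , lead) = <⇒≱ y<x x≤y
        where
        open ≤-Reasoning
        y<x : shiftBody y < shiftBody x
        y<x = <-≤-trans (m<n+m (shiftBody y) (s≤s z≤n)) lead
        x≤y : shiftBody x ≤ shiftBody y
        x≤y = begin
          shiftBody x                         ≤⟨ shiftBody-≤-ahead x px t (≤-trans (m≤m+n (suc t) _) lead) ⟩
          shift (at (initial x) d (suc t))    ≡⟨ cong shift ahead ⟨
          shift (initial y)                   ≤⟨ shift≤shiftBody y ⟩
          shiftBody y                         ∎

      collision-free : ∀ {x y} → Present x → Present y → x ≢ y → ∀ a r → 1 ≤ a →
                       r • initial x ⊕ a • final move x ≢ r • initial y ⊕ a • final move y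
      collision-free {x} {y} px py x≢y a r 1≤a meet =
        impossible
          (meet⇒overtake d a r 1≤a (initial x) (initial y) (shiftBody x) (shiftBody y) meet-shifted)
        where
        meet-shifted : r • initial x ⊕ a • at (initial x) d (shiftBody x) ≡
                       r • initial y ⊕ a • at (initial y) d (shiftBody y)
        meet-shifted = subst₂ (λ p q → r • initial x ⊕ a • p ≡ r • initial y ⊕ a • q)
                              (final-at x) (final-at y) meet
        impossible : (initial x ≡ initial y × shiftBody x ≡ shiftBody y) ⊎
          Overtakes d (initial x) (shiftBody x) (initial y) (shiftBody y) ⊎
          Overtakes d (initial y) (shiftBody y) (initial x) (shiftBody x) → ⊥
        impossible (inj₁ (initial≡ , shift≡))   = x≢y (body-unique x y initial≡ shift≡)
        impossible (inj₂ (inj₁ x-overtakes-y)) = ¬overtakes x y px x-overtakes-y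
        impossible (inj₂ (inj₂ y-overtakes-x)) = ¬overtakes y x py y-overtakes-x

      Link : Rel Point 0ℓ
      Link p q = ∃[ x ] ∃[ y ] SymClosure Edge x y × final move x ≡ p × final move y ≡ q

      Link-sym : Symmetric Link
      Link-sym (x , y , e , x≡ , y≡) = y , x , symmetric Edge e , y≡ , x≡

      edge-present : ∀ {x y} → Edge x y → Present x × Present y
      edge-present (kept e _)           = Shape.~-node S e , Shape.~-node S (Shape.~-sym S e)
      edge-present (grown o)            = from node⇔ (op-reached o) , o
      edge-present (spliced e (o , _)) = o , Shape.~-node S (Shape.~-sym S e)

      link-present : ∀ {x y} → SymClosure Edge x y → Present x × Present y
      link-present (fwd e) = edge-present e
      link-present (bwd e) = Product.swap (edge-present e)

      segment-edge-present : ∀ {b m x} → Segment T u₀ i b d m → x < m → x < w →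
                             Shape._~_ S (at b d x) (at b d (suc x))
      segment-edge-present s x<m x<w = from edge⇔
        (segment-edge s x<m , segment-reached s (<⇒≤ x<m) (<⇒≤ x<w) , segment-reached s x<m x<w)

      segment-link : ∀ {b m z} → Segment T u₀ i b d m → z < m → z < suc (w + w) →
                     Link (at b d z) (at b d (suc z))
      segment-link {b} {m} {z} s z<m z<double with edgeOrigin w m z<m z<double
      ... | kept x x≮μ x<w refl = old (at b d x) , old (at b d (suc x)) ,
          fwd (kept (segment-edge-present s x<m x<w) (segment-¬splits s x<m x≮μ)) ,
          move-segment s (<⇒≤ x<m) , move-segment-suc-≮ s x<m x≮μ
        where
        x<m : x < m
        x<m = ≤-<-trans (m≤m+n x _) z<m
      ... | grown y y<μ refl = old (at b d y) , new (at b d y) , fwd (grown (op s y y<μ refl)) ,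
          move-segment s (<quota⇒≤len w m y<μ) , move-new s y<μ
      ... | spliced y y<μ y<w refl = new (at b d y) , old (at b d (suc y)) ,
          fwd (spliced (segment-edge-present s y<m y<w) (segment-toward s y<μ)) ,
          move-new s y<μ , move-segment-suc-< s y<μ
        where
        y<m : y < m
        y<m = <quota⇒<len w m y<μ

      child-link : ∀ {p c} → Parent p c → Reached i cap′ c → Link p c
      child-link {p} {c} child c-reached with childView d child (reached⇒within c-reached)
      ... | along s x x<m refl refl = segment-link s x<m (reached-offset-after s x<m c-reached)
      ... | apart p-fixed c-fixed = old p , old c ,
        fwd (kept p~c (fixed-¬splits child c-fixed)) ,
        move-fixed p-fixed , move-fixed c-fixed
        where
        unchanged : ∀ {v} → ¬ Movable v → Reached i cap′ v → Reached i cap v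
        unchanged = reached-off-dir (double-other d cap)
        p-reached : Reached i cap′ p
        p-reached = reached-parent-closed i cap′ child c-reached
        p~c : Shape._~_ S p c
        p~c = from edge⇔ (parent⇒~ child , unchanged p-fixed p-reached , unchanged c-fixed c-reached)

      link : ∀ {p q} → Inside T (Reached i cap′) p q → Link p q
      link (e , p-reached , q-reached) with ~⇒parent e
      ... | inj₁ child = child-link child q-reached
      ... | inj₂ child = Link-sym (child-link child p-reached)

      kept-child-adjacent : ∀ {p c} → Parent p c → Reached i cap c → ¬ Splits p c → move p ~ move c
      kept-child-adjacent child c-reached ¬splits
        with childView d child (reached⇒within c-reached)
      ... | apart p-fixed c-fixed =
        subst₂ _~_ (sym (move-fixed p-fixed)) (sym (move-fixed c-fixed)) (parent⇒~ child)
      ... | along {b} {m} s x x<m refl refl =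
        subst₂ _~_ (sym (move-segment s (<⇒≤ x<m))) (sym (move-segment-suc-≮ s x<m x≮μ))
          (segment-edge s (subst (_≤ m) (stretch-suc-≮ x≮μ)
            (stretch-≤len w m (reached-offset s x<m c-reached) x<m)))
        where
        x≮μ : ¬ x < quota w m
        x≮μ x<μ = ¬splits (inj₁ (segment-toward s x<μ))

      edge-adjacent : ∀ {x y} → Edge x y → final move x ~ final move y
      edge-adjacent (kept e ¬splits) with to edge⇔ e
      ... | e′ , u-reached , v-reached with ~⇒parent e′
      ...   | inj₁ child = kept-child-adjacent child v-reached ¬splits
      ...   | inj₂ child = ~-sym (kept-child-adjacent child u-reached (¬splits ∘ Sum.swap))
      edge-adjacent (grown (op {m = m} s y y<μ refl)) =
        subst₂ _~_ (sym (move-segment s (<quota⇒≤len w m y<μ))) (sym (move-new s y<μ))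
          (segment-edge s (stretch-<len w m y<μ))
      edge-adjacent (spliced e (op {b} {m} s y y<μ refl , refl)) =
        subst₂ _~_ (sym (move-new s y<μ)) (sym moved)
          (segment-edge s (subst (_≤ m) (stretch-suc-< y<μ) (stretch-≤len w m y<w y<m)))
        where
        y<m : y < m
        y<m = <quota⇒<len w m y<μ
        y<w : y < w
        y<w = reached-offset s y<m
          (subst (Reached i cap) (sym (at-suc b d y)) (proj₂ (proj₂ (to edge⇔ e))))
        moved : move (at b d y ⊕ vec d) ≡ at b d (2 + stretch (quota w m) y)
        moved = trans (cong move (sym (at-suc b d y))) (move-segment-suc-< s y<μ)

      present-at : ∀ {p} → Reached i cap′ p → ∃[ x ] Present x × final move x ≡ p
      present-at {p} reached with on-segment? i d p
      ... | no fixed =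
        old p , from node⇔ (reached-off-dir (double-other d cap) fixed reached) , move-fixed fixed
      ... | yes (on s x x<m refl)
        with _ , y , e , _ , y≡ ← segment-link s x<m (reached-offset-after s x<m reached) =
        y , proj₂ (link-present e) , y≡

      body⇒node′ : ∀ {p} → ∃[ x ] Present x × final move x ≡ p → p ∈ Shape.nodes S′
      body⇒node′ (x , px , refl) = from node′⇔ (final-reached x px)

      link⇒edge′ : ∀ {p q} → Link p q → Shape._~_ S′ p q
      link⇒edge′ (x , y , e , refl , refl) =
        from edge′⇔ (adjacent e , final-reached x x-present , final-reached y y-present)
        where
        x-present : Present x
        x-present = proj₁ (link-present e)
        y-present : Present y
        y-present = proj₂ (link-present e)
        adjacent : ∀ {x y} → SymClosure Edge x y → final move x ~ final move y
        adjacent (fwd e) = edge-adjacent e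
        adjacent (bwd e) = ~-sym (edge-adjacent e)

      doublingStep : Step u₀ S S′
      doublingStep = record
        { tree           = IsTree-Spans S-spans tree
        ; anchor         = from node⇔ (earlier start (s≤s z≤n))
        ; ops            = ops
        ; move           = move
        ; move-def       = λ {v} p → cong (v ⊕_) (sym (displacement-shift p))
        ; collision-free = collision-free
        ; nodes′         = λ p → mk⇔ (present-at ∘ to node′⇔) body⇒node′
        ; edges′         = λ p q → mk⇔ (link ∘ to edge′⇔) link⇒edge′
        }

      fastLineStep : FastLineStep T u₀ i doublingStep
      fastLineStep = record
        { only-segments = λ { (op {b} {m} s y y<μ refl) →
            b , m , s , ∈-line⁺ b d m (<quota⇒≤len w m y<μ) }
        ; all-segments  = double-or-complete
        }
        where
        double-or-complete : ∀ {b m} → Segment T u₀ i b d m →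
          (∀ {u} → u ∈ Shape.nodes S → u ∈ b ∷ line b d m → Op u) ⊎
          (∀ {u} → u ∈ line b d m → u ∈ Shape.nodes S′)
        double-or-complete {b} {m} s with suc (w + w) ≤? m
        ... | yes double≤m = inj₁ operate
          where
          operate : ∀ {u} → u ∈ Shape.nodes S → u ∈ b ∷ line b d m → Op u
          operate u∈S u∈line with x , x≤m , refl ← ∈-line⁻ b d m u∈line =
            op s x (quota-full w m double≤m (reached-offset s x≤m (to node⇔ u∈S))) refl
        ... | no double≰m = inj₂ complete
          where
          complete : ∀ {u} → u ∈ line b d m → u ∈ Shape.nodes S′
          complete u∈line with x , x≤m , refl ← ∈-line⁻ b d m (there u∈line) =
            from node′⇔ (segment-reached-after s x≤m (≤-trans x≤m (<⇒≤ (≰⇒> double≰m))))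

  -- Phases

  Completes : ℕ → Pred Point 0ℓ → ℕ → Set₁
  Completes i P t = ∀ {S} → Spans T P S → ∃[ g ] Phase T u₀ i {S} {t} g

  double-completes : ∀ {j cap t} d → Completes (suc j) (Reached (suc j) (double d cap)) t →
                     Completes (suc j) (Reached (suc j) cap) (suc t)
  double-completes {j} {cap} d rest S-spans with g , phase ← rest (spans-stage (suc j) (double d cap)) =
    doublingStep S-spans S′-spans ∷ g , grow (fastLineStep S-spans S′-spans) phase
    where
    open Doubling j d cap using (doublingStep; fastLineStep)
    S′-spans : Spans T (Reached (suc j) (double d cap)) (stage (suc j) (double d cap))
    S′-spans = spans-stage (suc j) (double d cap)

  rounds-complete : ∀ {j cap t} n → Completes (suc j) (Reached (suc j) (iterate doubleAll cap n)) t →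
                    Completes (suc j) (Reached (suc j) cap) (n * 4 + t)
  rounds-complete zero    rest = rest
  rounds-complete (suc n) rest = double-completes north (double-completes east
    (double-completes south (double-completes west (rounds-complete n rest))))

  module _ (L : ℕ) (size≤2^L : Shape.size T ≤ 2 ^ L) where

    phase-completes : ∀ {j t} → Completes (2 + j) (Within T u₀ (suc j)) t →
                      Completes (suc j) (Within T u₀ j) (L * 4 + t)
    phase-completes {j} {t} rest S-spans =
      rounds-complete L next-phase (Spans-resp-⇔ within⇔unstarted S-spans)
      where
      full : Dir → ℕ
      full = iterate doubleAll (const 0) L
      size≤1+full : ∀ d → Shape.size T ≤ suc (full d)
      size≤1+full d = begin
        Shape.size T      ≤⟨ size≤2^L ⟩
        2 ^ L             ≡⟨ *-identityʳ (2 ^ L) ⟨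
        2 ^ L * 1         ≡⟨ suc-iterate-doubleAll L (const 0) d ⟨
        suc (full d)      ∎
        where open ≤-Reasoning
      next-phase : Completes (suc j) (Reached (suc j) full) t
      next-phase S-spans =
        let S-within  = Spans-resp-⇔ (reached⇔within (s≤s z≤n) size≤1+full) S-spans
            g , phase = rest S-within
        in g , next ((λ p → Spans.node⇔ S-within) , (λ p q → Spans.edge⇔ S-within)) phase

    phases-complete : ∀ n {j} → (∀ {v ps} → RootPath v ps → segments ps ≤ j + n) →
                      Completes (suc j) (Within T u₀ j) (n * (L * 4))
    phases-complete zero {j} bound S-spans =
      done (Spans-nodes⇒≋ (Spans-resp-⇔ within⇔node S-spans)) , finish
      where
      within⇔node : ∀ {v} → Within T u₀ j v ⇔ v ∈ Shape.nodes T
      within⇔node = mk⇔ within⇒node λ v∈ → let ps , p = root-path v∈ in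
        ps , p , ≤-trans (bound p) (≤-reflexive (+-identityʳ j))
    phases-complete (suc n) {j} bound =
      phase-completes (phases-complete n (λ p → ≤-trans (bound p) (≤-reflexive (+-suc j n))))

  spans-singleton : Spans T (Within T u₀ 0) (singleton u₀)
  spans-singleton = spans
    (mk⇔ (λ { (here refl) → _ , start , z≤n }) (here ∘ only-root))
    (mk⇔ (λ ()) λ (e , wp , wq) → ~-irrefl T (subst₂ _~_ (only-root wp) (only-root wq) e))
    where
    only-root : ∀ {v} → Within T u₀ 0 v → v ≡ u₀
    only-root (_ , start , _) = refl
    only-root (_ , extend {b} p _ _ , seg≤0) with _ , refl ← path-head p with () ← seg≤0

theorem3p1 : ∀ (c : ℕ) → ∃[ C ]
      (∀ (T : Shape) → IsTree T →
       ∀ (u₀ : Point) → u₀ ∈ Shape.nodes T →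
       ∀ (k : ℕ) → (∀ {v ps} → RootToLeaf T u₀ v ps → turningPoints ps ≤ c * k) →
       ∃[ t ] ∃[ g ] (BFSOnLineSegments T u₀ {t} g × t ≤ C * (k * ⌊log₂ Shape.size T ⌋)))
theorem3p1 c = 8 * c , λ T tree u₀ u₀∈ k bound →
  let open Tree T tree u₀ u₀∈
      g , bfs = phases-complete (2 * ⌊log₂ Shape.size T ⌋) (n≤2^[2*⌊log₂n⌋] (Shape.size T)) (c * k)
                  (segments-≤ (≤-trans pred[n]≤n ∘ bound)) spans-singleton
  in _ , g , bfs , ≤-reflexive (regroup c k ⌊log₂ Shape.size T ⌋)
  where
  regroup : ∀ c k l → c * k * (2 * l * 4) ≡ 8 * c * (k * l)
  regroup = ℕ-Solver.solve-∀
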